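{- There is an algorithm which, given a permutation $\pi$ of $\{1,\dots,n\}$, outputs a maximum induced matching of the permutation graph $G(\pi)$ in $\mathcal{O}(m+n)$ time, where $m$ is the number of edges of $G(\pi)$.
   Context: For a permutation $\pi=(\pi(1),\dots,\pi(n))$ of $\{1,\dots,n\}$, $\pi^{ -1}(i)$ denotes the position of $i$ in $\pi$. The permutation graph $G(\pi)=(V,E)$ has $V=\{1,\dots,n\}$ and $uv\in E$ iff $(u-v)(\pi^{ -1}(u)-\pi^{ -1}(v))<0$. An induced matching of a graph $G=(V,E)$ is a set $M\subseteq E$ such that for any two distinct edges $u_1v_1,u_2v_2\in M$, none of $u_1u_2,u_1v_2,v_1u_2,v_1v_2$ is in $E$ (in particular the edges are vertex-disjoint). A maximum induced matching is one of maximum cardinality. Running times are in the standard RAM model. -}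

module Defs where

open import Data.Fin.Base as Fin using (Fin; toℕ)
import Data.Fin.Properties as Fin
open import Data.Fin.Permutation using (Permutation′; _⟨$⟩ʳ_; _⟨$⟩ˡ_)
open import Data.Integer.Base as ℤ using (ℤ; 0ℤ)
import Data.Integer.Properties as ℤ
open import Data.List.Base
  using (List; []; _∷_; length; map; concatMap; filter; allFin; cartesianProduct)
open import Data.List.Membership.Propositional using (_∈_)
open import Data.List.Relation.Binary.Subset.Propositional using (_⊆_)
open import Data.List.Relation.Unary.Unique.Propositional using (Unique)
open import Data.Maybe.Base using (Maybe; just; nothing)
open import Data.Nat.Base using (ℕ; zero; suc; _+_; _*_; _∸_; _/_; _<_; _≤_; _≮_)
open import Data.Nat.Properties using (_≟_)
open import Data.Product.Base using (_×_; _,_)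
open import Data.Unit.Base using (⊤)
open import Level using (0ℓ)
open import Relation.Binary.Core using (Rel)
open import Relation.Binary.Definitions using (Symmetric; Irreflexive; Decidable)
open import Relation.Binary.PropositionalEquality
  using (_≡_; _≢_; refl; sym; trans; cong; cong₂; subst; module ≡-Reasoning)
open import Relation.Nullary.Decidable using (_×-dec_; yes; no)
open import Relation.Nullary.Negation using (¬_)

record Graph (n : ℕ) : Set₁ where
  field
    _~_    : Rel (Fin n) 0ℓ
    ~-sym  : Symmetric _~_
    ~-irr  : Irreflexive _≡_ _~_
    _~?_   : Decidable _~_

module _ {n : ℕ} (G : Graph n) where
  open Graph G

  -- Each undirected edge occurs exactly once, with its smaller endpoint first.
  edges : List (Fin n × Fin n)
  edges = filter (λ (u , v) → (u Fin.<? v) ×-dec (u ~? v))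
                 (cartesianProduct (allFin n) (allFin n))

  ∣E∣ : ℕ
  ∣E∣ = length edges

  -- Finite edge sets are duplicate-free lists, so that length is cardinality.
  record IsInducedMatching (M : List (Fin n × Fin n)) : Set where
    field
      unique  : Unique M
      subset  : M ⊆ edges
      induced : ∀ {u₁ v₁ u₂ v₂} → (u₁ , v₁) ∈ M → (u₂ , v₂) ∈ M →
                (u₁ , v₁) ≢ (u₂ , v₂) →
                ¬ (u₁ ~ u₂) × ¬ (u₁ ~ v₂) × ¬ (v₁ ~ u₂) × ¬ (v₁ ~ v₂)

  IsMaximumInducedMatching : List (Fin n × Fin n) → Set
  IsMaximumInducedMatching M =
    IsInducedMatching M × (∀ M′ → IsInducedMatching M′ → length M′ ≤ length M)

-- Fin n stands for {1,…,n}.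
label : ∀ {n} → Fin n → ℕ
label i = suc (toℕ i)

-- π ⟨$⟩ʳ i is the entry π(i); π ⟨$⟩ˡ v is the position π⁻¹(v).
module _ {n : ℕ} (π : Permutation′ n) where

  private
    diff : Fin n → Fin n → ℤ
    diff u v = ℤ.+ label u ℤ.- ℤ.+ label v

    inv : Fin n → Fin n → ℤ
    inv u v = diff u v ℤ.* diff (π ⟨$⟩ˡ u) (π ⟨$⟩ˡ v)

    diff-swap : ∀ u v → diff v u ≡ ℤ.- diff u v
    diff-swap u v = begin
      ℤ.+ label v ℤ.- ℤ.+ label u  ≡⟨ ℤ.m-n≡m⊖n (label v) (label u) ⟩
      label v ℤ.⊖ label u          ≡⟨ ℤ.⊖-swap (label v) (label u) ⟩
      ℤ.- (label u ℤ.⊖ label v)    ≡⟨ cong ℤ.-_ (ℤ.m-n≡m⊖n (label u) (label v)) ⟨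
      ℤ.- diff u v                 ∎
      where open ≡-Reasoning

    inv-swap : ∀ u v → inv v u ≡ inv u v
    inv-swap u v = begin
      diff v u ℤ.* diff v′ u′              ≡⟨ cong₂ ℤ._*_ (diff-swap u v) (diff-swap u′ v′) ⟩
      (ℤ.- diff u v) ℤ.* (ℤ.- diff u′ v′)  ≡⟨ ℤ.neg-distribˡ-* (diff u v) (ℤ.- diff u′ v′) ⟨
      ℤ.- (diff u v ℤ.* (ℤ.- diff u′ v′))  ≡⟨ cong ℤ.-_ (ℤ.neg-distribʳ-* (diff u v) (diff u′ v′)) ⟨
      ℤ.- (ℤ.- inv u v)                    ≡⟨ ℤ.neg-involutive (inv u v) ⟩
      inv u v                              ∎
      where
        open ≡-Reasoning
        u′ = π ⟨$⟩ˡ u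
        v′ = π ⟨$⟩ˡ v

    inv-self : ∀ u → inv u u ≡ 0ℤ
    inv-self u = cong (ℤ._* diff (π ⟨$⟩ˡ u) (π ⟨$⟩ˡ u)) (ℤ.+-inverseʳ (ℤ.+ label u))

  permutationGraph : Graph n
  permutationGraph = record
    { _~_   = λ u v →
        (ℤ.+ label u ℤ.- ℤ.+ label v) ℤ.*
        (ℤ.+ label (π ⟨$⟩ˡ u) ℤ.- ℤ.+ label (π ⟨$⟩ˡ v)) ℤ.< 0ℤ
    ; ~-sym = λ {u} {v} → subst (ℤ._< 0ℤ) (sym (inv-swap u v))
    ; ~-irr = λ { {u} refl p → ℤ.<-irrefl (inv-self u) p }
    ; _~?_  = λ u v → inv u v ℤ.<? 0ℤ
    }

-- A program is a fixed finite instruction list acting on registers (named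
-- statically) and on a memory addressed through register contents.  Every
-- instruction costs one unit.  Words are naturals below a bound W; unit cost
-- is reasonable because an instruction whose result is not below W cannot be
-- executed.

data Op : Set where
  add sub mul div : Op

⟦_⟧ : Op → ℕ → ℕ → ℕ
⟦ add ⟧ x y       = x + y
⟦ sub ⟧ x y       = x ∸ y
⟦ mul ⟧ x y       = x * y
⟦ div ⟧ x zero    = zero
⟦ div ⟧ x (suc y) = x / suc y

Reg Addr : Set
Reg  = ℕ
Addr = ℕ

data Instr : Set where
  const : Reg → ℕ → Instr               -- r ← k
  move  : Reg → Reg → Instr             -- r ← s
  arith : Op → Reg → Reg → Reg → Instr  -- r ← s ∘ t
  load  : Reg → Reg → Instr             -- r ← mem[s]
  store : Reg → Reg → Instr             -- mem[r] ← s
  jump  : ℕ → Instr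
  jlt   : Reg → Reg → ℕ → Instr         -- if r < s go to l
  jeq   : Reg → Reg → ℕ → Instr         -- if r = s go to l
  halt  : Instr

Program : Set
Program = List Instr

fetch : Program → ℕ → Maybe Instr
fetch []      _       = nothing
fetch (i ∷ _) zero    = just i
fetch (_ ∷ p) (suc k) = fetch p k

_[_↦_] : (ℕ → ℕ) → ℕ → ℕ → (ℕ → ℕ)
(f [ a ↦ x ]) b with b ≟ a
... | yes _ = x
... | no  _ = f b

record State : Set where
  constructor ⟨_,_,_⟩
  field
    pc   : ℕ
    regs : Reg → ℕ
    mem  : Addr → ℕ

data Step (W : ℕ) (P : Program) : State → State → Set where
  const : ∀ {l R m r k} → fetch P l ≡ just (const r k) → k < W →
          Step W P ⟨ l , R , m ⟩ ⟨ suc l , R [ r ↦ k ] , m ⟩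
  move  : ∀ {l R m r s} → fetch P l ≡ just (move r s) →
          Step W P ⟨ l , R , m ⟩ ⟨ suc l , R [ r ↦ R s ] , m ⟩
  arith : ∀ {l R m o r s t} → fetch P l ≡ just (arith o r s t) →
          ⟦ o ⟧ (R s) (R t) < W →
          Step W P ⟨ l , R , m ⟩ ⟨ suc l , R [ r ↦ ⟦ o ⟧ (R s) (R t) ] , m ⟩
  load  : ∀ {l R m r s} → fetch P l ≡ just (load r s) →
          Step W P ⟨ l , R , m ⟩ ⟨ suc l , R [ r ↦ m (R s) ] , m ⟩
  store : ∀ {l R m r s} → fetch P l ≡ just (store r s) →
          Step W P ⟨ l , R , m ⟩ ⟨ suc l , R , m [ R r ↦ R s ] ⟩
  jump  : ∀ {l R m l′} → fetch P l ≡ just (jump l′) →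
          Step W P ⟨ l , R , m ⟩ ⟨ l′ , R , m ⟩
  jlt-t : ∀ {l R m r s l′} → fetch P l ≡ just (jlt r s l′) → R r < R s →
          Step W P ⟨ l , R , m ⟩ ⟨ l′ , R , m ⟩
  jlt-f : ∀ {l R m r s l′} → fetch P l ≡ just (jlt r s l′) → R r ≮ R s →
          Step W P ⟨ l , R , m ⟩ ⟨ suc l , R , m ⟩
  jeq-t : ∀ {l R m r s l′} → fetch P l ≡ just (jeq r s l′) → R r ≡ R s →
          Step W P ⟨ l , R , m ⟩ ⟨ l′ , R , m ⟩
  jeq-f : ∀ {l R m r s l′} → fetch P l ≡ just (jeq r s l′) → R r ≢ R s →
          Step W P ⟨ l , R , m ⟩ ⟨ suc l , R , m ⟩

-- Run W P σ t τ: from σ, P halts in state τ after executing t instructions.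
data Run (W : ℕ) (P : Program) : State → ℕ → State → Set where
  halt : ∀ {σ} → fetch P (State.pc σ) ≡ just halt → Run W P σ 1 σ
  step : ∀ {σ σ′ t τ} → Step W P σ σ′ → Run W P σ′ t τ → Run W P σ (suc t) τ

contents : List ℕ → Addr → ℕ
contents []       _       = 0
contents (x ∷ _)  zero    = x
contents (_ ∷ xs) (suc a) = contents xs a

initial : List ℕ → State
initial xs = ⟨ 0 , (λ _ → 0) , contents xs ⟩

StoredAt : (Addr → ℕ) → Addr → List ℕ → Set
StoredAt m a []       = ⊤
StoredAt m a (x ∷ xs) = m a ≡ x × StoredAt m (suc a) xs

-- n, π(1), …, π(n)
encodePermutation : ∀ {n} → Permutation′ n → List ℕ
encodePermutation {n} π = n ∷ map (λ i → label (π ⟨$⟩ʳ i)) (allFin n)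

-- |M|, u₁, v₁, u₂, v₂, …
encodeEdges : ∀ {n} → List (Fin n × Fin n) → List ℕ
encodeEdges M = length M ∷ concatMap (λ (u , v) → label u ∷ label v ∷ []) M

Outputs : ∀ {n} → State → List (Fin n × Fin n) → Set
Outputs τ M = StoredAt (State.mem τ) 0 (encodeEdges M)

{-# OPTIONS --safe #-}
module Submission where

open import Defs
open import Data.Nat.Base using (ℕ; suc; _+_; _*_; _^_; _≤_)
open import Data.Product.Base using (_×_; ∃-syntax)
open import Data.Fin.Permutation using (Permutation′)

-- Write an edge as q < p with pos p < pos q.  The edges of an induced matching
-- are ordered by value and by position at once, so they form a chain: p₁ < q₂
-- and pos q₁ < pos p₂ for consecutive edges.  Sweep the positions from right to
-- left and keep, for every k, the largest lower vertex top k of the first edge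
-- of a chain of k edges among the swept positions; the longest chain with all
-- values above v has then rank v = #{k : v < top k} edges.
--
-- When p enters the sweep, rank v is needed only for the unswept v > p, which
-- are neighbours of p.  The unswept values are linked downwards from n + 1, and
-- each one counts the tops in the gap below it, so one walk down to p yields
-- all these ranks; v remembers the best continuation of an edge (p, v).  When v
-- itself enters, its best edge raises at most one top.  The gaps of the old and
-- the new top are found by walking upwards through swept values below v, which
-- are neighbours of v.  Every step of a walk is thus charged to its own edge.

open import Algebra.Properties.CommutativeSemigroup using (interchange; x∙yz≈y∙xz)
open import Data.Bool.Base using (T; if_then_else_)
open import Data.Fin.Base as Fin using (Fin; toℕ; fromℕ<)
open import Data.Fin.Permutation using (_⟨$⟩ʳ_; _⟨$⟩ˡ_; inverseˡ; inverseʳ)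
open import Data.Fin.Properties using (toℕ<n; toℕ-fromℕ<; fromℕ<-toℕ; toℕ-injective)
import Data.Fin.Properties as Fin
open import Data.Integer.Base as ℤ using (ℤ; 0ℤ)
import Data.Integer.Properties as ℤ
open import Data.List.Base
  using (List; []; _∷_; _++_; concatMap; filter; length; map; tabulate; allFin; cartesianProduct)
open import Data.List.Membership.Propositional using (_∈_)
open import Data.List.Membership.Propositional.Properties
  using (∈-filter⁺; ∈-filter⁻; ∈-cartesianProduct⁺; ∈-allFin)
open import Data.List.Properties using (filter-++; length-++; length-map; length-tabulate)
open import Data.List.Relation.Unary.All as All using (All; []; _∷_)
open import Data.List.Relation.Unary.AllPairs as AllPairs using (AllPairs; []; _∷_)
open import Data.List.Relation.Unary.Any using (here; there)
open import Data.Maybe.Base using (just)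
open import Data.Nat.Base hiding (ℕ; suc; _+_; _*_; _^_; _≤_)
open import Data.Nat.DivMod using (m<n⇒m%n≡m; [m+kn]%n≡m%n)
open import Data.Nat.ListAction using (sum)
open import Data.Nat.Properties
open import Data.Nat.Tactic.RingSolver using (solve-∀)
open import Data.Product.Base using (_,_; proj₁; proj₂)
open import Data.Sum.Base using (_⊎_; inj₁; inj₂; [_,_]′)
open import Function.Base using (_∘_; id; case_of_)
open import Relation.Binary.Definitions using (tri<; tri≈; tri>)
open import Relation.Binary.PropositionalEquality
open import Relation.Nullary.Decidable using (Dec; does; yes; no; _×-dec_)
open import Relation.Nullary.Negation using (¬_; contradiction)

-- An edge with lower vertex p and upper vertex v matters at two moments. Its continuation has to
-- lie beyond the position of p, so the longest one is determined when p enters the sweep; but the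
-- edge can open a chain of swept positions only once v enters as well. This delay is why each
-- unswept v has to remember an edge. One edge per v is enough. If another edge of v continues by
-- fewer edges than the best one, then an initial part of the best continuation is a chain of the
-- same total length, and it starts above v, hence higher. For the same reason v raises only the top
-- one level above its best continuation. A binary search among the tops would find each rank too,
-- but at a logarithmic cost per edge; gaps and marks exist to avoid it.

private variable
  C D : Set

-- Point updates, indicators and finite sums

↦-same : ∀ (f : ℕ → ℕ) a {x} → (f [ a ↦ x ]) a ≡ x
↦-same f a with a ≟ a
... | yes _  = refl
... | no a≢a = contradiction refl a≢a

↦-other : ∀ (f : ℕ → ℕ) {a b x} → b ≢ a → (f [ a ↦ x ]) b ≡ f b
↦-other f {a} {b} b≢a with b ≟ a
... | yes b≡a = contradiction b≡a b≢a
... | no _    = refl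

𝟙 : Dec C → ℕ
𝟙 d = if does d then 1 else 0

𝟙-yes : (d : Dec C) → C → 𝟙 d ≡ 1
𝟙-yes (yes _) _ = refl
𝟙-yes (no ¬a) a = contradiction a ¬a

𝟙-no : (d : Dec C) → ¬ C → 𝟙 d ≡ 0
𝟙-no (yes a) ¬a = contradiction a ¬a
𝟙-no (no _)  _  = refl

𝟙≤1 : (d : Dec C) → 𝟙 d ≤ 1
𝟙≤1 (yes _) = ≤-refl
𝟙≤1 (no _)  = z≤n

𝟙-mono : (d : Dec C) (e : Dec D) → (C → D) → 𝟙 d ≤ 𝟙 e
𝟙-mono (yes a) e f = ≤-reflexive (sym (𝟙-yes e (f a)))
𝟙-mono (no _)  e f = z≤n

sumTo : ℕ → (ℕ → ℕ) → ℕ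
sumTo zero    f = 0
sumTo (suc N) f = f N + sumTo N f

sumTo-mono : ∀ N {f g} → (∀ i → f i ≤ g i) → sumTo N f ≤ sumTo N g
sumTo-mono zero    f≤g = z≤n
sumTo-mono (suc N) f≤g = +-mono-≤ (f≤g N) (sumTo-mono N f≤g)

sumTo-monoˡ : ∀ f {M N} → M ≤ N → sumTo M f ≤ sumTo N f
sumTo-monoˡ f {N = zero}  z≤n = z≤n
sumTo-monoˡ f {M} {suc N} M≤1+N with M ≟ suc N
... | yes refl = ≤-refl
... | no M≢1+N = ≤-trans (sumTo-monoˡ f (s≤s⁻¹ (≤∧≢⇒< M≤1+N M≢1+N))) (m≤n+m _ (f N))

sumTo-cong : ∀ N {f g} → (∀ i → i < N → f i ≡ g i) → sumTo N f ≡ sumTo N g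
sumTo-cong zero    f≡g = refl
sumTo-cong (suc N) f≡g =
  cong₂ _+_ (f≡g N (n<1+n N)) (sumTo-cong N (λ i i<N → f≡g i (m<n⇒m<1+n i<N)))

sumTo-bound : ∀ N {f b} → (∀ i → f i ≤ b) → sumTo N f ≤ N * b
sumTo-bound zero    f≤b = z≤n
sumTo-bound (suc N) f≤b = +-mono-≤ (f≤b N) (sumTo-bound N f≤b)

sumTo-+ : ∀ N f g → sumTo N (λ i → f i + g i) ≡ sumTo N f + sumTo N g
sumTo-+ zero    f g = refl
sumTo-+ (suc N) f g = begin
  (f N + g N) + sumTo N (λ i → f i + g i)   ≡⟨ cong ((f N + g N) +_) (sumTo-+ N f g) ⟩
  (f N + g N) + (sumTo N f + sumTo N g)     ≡⟨ interchange +-commutativeSemigroup (f N) (g N) _ _ ⟩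
  (f N + sumTo N f) + (g N + sumTo N g)     ∎
  where open ≡-Reasoning

sumTo-0 : ∀ N → sumTo N (λ _ → 0) ≡ 0
sumTo-0 zero    = refl
sumTo-0 (suc N) = sumTo-0 N

sumTo-swap : ∀ M N (f : ℕ → ℕ → ℕ) → sumTo M (λ i → sumTo N (f i)) ≡ sumTo N (λ j → sumTo M (λ i → f i j))
sumTo-swap zero    N f = sym (sumTo-0 N)
sumTo-swap (suc M) N f =
  trans (cong (sumTo N (f M) +_) (sumTo-swap M N f)) (sym (sumTo-+ N (f M) _))

sumTo-head : ∀ N f → sumTo (suc N) f ≡ f 0 + sumTo N (f ∘ suc)
sumTo-head zero    f = refl
sumTo-head (suc N) f = begin
  f (suc N) + sumTo (suc N) f              ≡⟨ cong (f (suc N) +_) (sumTo-head N f) ⟩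
  f (suc N) + (f 0 + sumTo N (f ∘ suc))    ≡⟨ x∙yz≈y∙xz +-commutativeSemigroup (f (suc N)) (f 0) _ ⟩
  f 0 + (f (suc N) + sumTo N (f ∘ suc))    ∎
  where open ≡-Reasoning

sumTo-gain : ∀ N {f g} j a → j < N → (∀ i → f i ≤ g i) → a + f j ≤ g j →
             a + sumTo N f ≤ sumTo N g
sumTo-gain (suc N) {f} {g} j a j<1+N f≤g gain with j ≟ N
... | yes refl = ≤-trans (≤-reflexive (sym (+-assoc a (f N) _))) (+-mono-≤ gain (sumTo-mono N f≤g))
... | no j≢N = begin
  a + (f N + sumTo N f)  ≡⟨ x∙yz≈y∙xz +-commutativeSemigroup a (f N) _ ⟩
  f N + (a + sumTo N f)  ≤⟨ +-mono-≤ (f≤g N) (sumTo-gain N j a (≤∧≢⇒< (s≤s⁻¹ j<1+N) j≢N) f≤g gain) ⟩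
  g N + sumTo N g        ∎
  where open ≤-Reasoning

-- Additive form: the change at j may go either way, and truncated subtraction could lose it.
sumTo-update : ∀ N {f g} j → j < N → (∀ i → i ≢ j → g i ≡ f i) →
               sumTo N g + f j ≡ sumTo N f + g j
sumTo-update (suc N) {f} {g} j j<1+N same with j ≟ N
... | yes refl = begin
  (g N + sumTo N g) + f N  ≡⟨ cong (λ s → (g N + s) + f N) (sumTo-cong N (λ i i<N → same i (<⇒≢ i<N))) ⟩
  (g N + sumTo N f) + f N  ≡⟨ +-comm _ (f N) ⟩
  f N + (g N + sumTo N f)  ≡⟨ cong (f N +_) (+-comm (g N) _) ⟩
  f N + (sumTo N f + g N)  ≡⟨ +-assoc (f N) _ (g N) ⟨
  (f N + sumTo N f) + g N  ∎
  where open ≡-Reasoning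
... | no j≢N = begin
  (g N + sumTo N g) + f j  ≡⟨ cong (λ s → (s + sumTo N g) + f j) (same N (≢-sym j≢N)) ⟩
  (f N + sumTo N g) + f j  ≡⟨ +-assoc (f N) _ (f j) ⟩
  f N + (sumTo N g + f j)  ≡⟨ cong (f N +_) (sumTo-update N j (≤∧≢⇒< (s≤s⁻¹ j<1+N) j≢N) same) ⟩
  f N + (sumTo N f + g j)  ≡⟨ +-assoc (f N) _ (g j) ⟨
  (f N + sumTo N f) + g j  ∎
  where open ≡-Reasoning

module _ {Q : ℕ → Set} (Q? : ∀ k → Dec (Q k)) (down : ∀ k → Q (suc k) → Q k) where

  private
    below : ∀ {j k} → j ≤ k → Q k → Q j
    below {zero}  {zero}  _ q = q
    below {j}     {suc k} j≤1+k q with j ≟ suc k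
    ... | yes refl = q
    ... | no j≢1+k = below (s≤s⁻¹ (≤∧≢⇒< j≤1+k j≢1+k)) (down k q)

    full : ∀ k → Q k → sumTo (suc k) (𝟙 ∘ Q?) ≡ suc k
    full zero    q = cong (_+ 0) (𝟙-yes (Q? 0) q)
    full (suc k) q = cong₂ _+_ (𝟙-yes (Q? (suc k)) q) (full k (down k q))

    short : ∀ k → ¬ Q k → ∀ N → sumTo N (𝟙 ∘ Q?) ≤ k
    short k ¬q zero    = z≤n
    short k ¬q (suc N) with Q? N
    ... | no _  = short k ¬q N
    ... | yes q with k ≤? N
    ...   | yes k≤N = contradiction (below k≤N q) ¬q
    ...   | no k≰N  = ≤-trans (s≤s (≤-trans (sumTo-bound N (𝟙≤1 ∘ Q?)) (≤-reflexive (*-identityʳ N)))) (≰⇒> k≰N)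

  -- The indices satisfying a downward closed `Q` form an initial segment, so their number marks its
  -- end. This lets a count of tops serve as the index of a longest chain.
  holds⇒<count : ∀ {N k} → k < N → Q k → k < sumTo N (𝟙 ∘ Q?)
  holds⇒<count {N} {k} k<N q = ≤-trans (≤-reflexive (sym (full k q))) (sumTo-monoˡ (𝟙 ∘ Q?) k<N)

  <count⇒holds : ∀ {N k} → k < sumTo N (𝟙 ∘ Q?) → Q k
  <count⇒holds {N} {k} k<s with Q? k
  ... | yes q = q
  ... | no ¬q = contradiction (short k ¬q N) (<⇒≱ k<s)

-- The sweep

-- At stage X the swept values are those with `X < pos v`. Values outside 1, ..., n get position 0,
-- so 0 and `suc n` are never swept and delimit the list of unswept values.
record Positions (n : ℕ) : Set where
  field
    pos val      : ℕ → ℕ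
    pos≤n        : ∀ v → pos v ≤ n
    in-range     : ∀ {v} → 0 < pos v → 0 < v × v ≤ n
    pos-positive : ∀ {v} → 0 < v → v ≤ n → 0 < pos v
    pos-val      : ∀ {x} → 0 < x → x ≤ n → pos (val x) ≡ x
    val-pos      : ∀ {v} → 0 < pos v → val (pos v) ≡ v

Field : Set
Field = ℕ

-- seen v = 1 iff v is swept.  For an unswept y, or y = n + 1, gap y is the
-- number of swept values directly below y and marks y the number of tops among
-- them.  The best edge with upper vertex v found so far is (partner v, v); it
-- continues by the chain of level v edges whose first upper vertex is next v.
-- node k is the first upper vertex of a chain attaining top k.  Vertices are
-- positive, so that 0 stands for a missing vertex.
seen gap marks level partner next top node : Field
seen    = 0
gap     = 1
marks   = 2
level   = 3
partner = 4
next    = 5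
top     = 6
node    = 7

Arrays : Set
Arrays = Field → ℕ → ℕ

put : Arrays → Field → ℕ → ℕ → Arrays
put A f j x g with g ≟ f
... | yes _ = A g [ j ↦ x ]
... | no _  = A g

prev : Arrays → ℕ → ℕ
prev A y = y ∸ A gap y ∸ 1

module Sweep {n : ℕ} (positions : Positions n) where
  open Positions positions

  private variable
    lo lo′ x x′ X r k p q u v y s z : ℕ
    A B : Arrays

  pos-injective : 0 < pos u → pos u ≡ pos v → u ≡ v
  pos-injective 0<u u≡v =
    trans (sym (val-pos 0<u)) (trans (cong val u≡v) (val-pos (subst (0 <_) u≡v 0<u)))

  free-below : pos p ≡ suc x → u ≢ p → pos u ≤ suc x → pos u ≤ x
  free-below p≡ u≢p u≤ = s≤s⁻¹ (≤∧≢⇒< u≤ λ u≡ →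
    u≢p (sym (pos-injective (subst (0 <_) (sym p≡) z<s) (trans p≡ (sym u≡)))))

  -- Chains of edges and their stored form

  Edge : ℕ → ℕ → Set
  Edge q p = q < p × pos p < pos q

  -- Only the first edge is bounded explicitly. As `lo < q < p` and `x < pos p < pos q`, the bounds
  -- handed to the tail are stronger, so the whole chain has values above lo and positions beyond x.
  data Chain (lo x : ℕ) : ℕ → Set where
    []   : Chain lo x 0
    cons : lo < q → x < pos p → Edge q p → Chain p (pos q) k → Chain lo x (suc k)

  chain-weaken : lo′ ≤ lo → x′ ≤ x → Chain lo x k → Chain lo′ x′ k
  chain-weaken lo≤ x≤ []             = []
  chain-weaken lo≤ x≤ (cons l p e c) = cons (≤-<-trans lo≤ l) (≤-<-trans x≤ p) e c

  chain-init : Chain lo x (suc k) → Chain lo x k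
  chain-init {k = zero}  c              = []
  chain-init {k = suc k} (cons l p e c) = cons l p e (chain-init c)

  -- Each edge uses up at least one value above lo. Levels therefore stay within n, and the n terms
  -- of `rank` see every top that is attained.
  chain-length : Chain lo x (suc k) → lo + suc k ≤ n
  chain-length {lo} {k = zero} (cons l p (q<p , _) c) =
    ≤-trans (≤-reflexive (+-comm lo 1)) (≤-trans l (≤-trans (<⇒≤ q<p) (proj₂ (in-range (≤-<-trans z≤n p)))))
  chain-length {lo} {k = suc k} (cons l p (q<p , _) c) =
    ≤-trans (≤-reflexive (+-suc lo (suc k)))
            (≤-trans (+-monoˡ-≤ (suc k) (<-trans l q<p)) (chain-length c))

  -- The same chain read off the arrays from its first upper vertex. The end marker 0 is what the
  -- output loop tests for.
  data Linked (A : Arrays) (lo x : ℕ) : ℕ → ℕ → Set where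
    []   : Linked A lo x 0 0
    cons : lo < A partner p → x < pos p → Edge (A partner p) p →
           Linked A p (pos (A partner p)) (A next p) k → Linked A lo x p (suc k)

  linked-weaken : lo′ ≤ lo → x′ ≤ x → Linked A lo x r k → Linked A lo′ x′ r k
  linked-weaken lo≤ x≤ []             = []
  linked-weaken lo≤ x≤ (cons l p e c) = cons (≤-<-trans lo≤ l) (≤-<-trans x≤ p) e c

  linked⇒chain : Linked A lo x r k → Chain lo x k
  linked⇒chain []             = []
  linked⇒chain (cons l p e c) = cons l p e (linked⇒chain c)

  Agree : ℕ → Arrays → Arrays → Set
  Agree X A B = ∀ {p} → X < pos p → A partner p ≡ B partner p × A next p ≡ B next p

  -- A stored chain reads `partner` and `next` only at its upper vertices, all of them swept,
  -- whereas the sweep rewrites these fields only at unswept vertices. Chains can thus share their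
  -- tails without being copied.
  linked-stable : Agree X A B → X ≤ x → Linked A lo x r k → Linked B lo x r k
  linked-stable agree X≤x [] = []
  linked-stable {B = B} agree X≤x (cons {p} {k} l x<p e c)
    with agree (≤-<-trans X≤x x<p)
  ... | e₁ , e₂ = cons
    (subst (_ <_) e₁ l) x<p (subst (λ q → Edge q p) e₁ e)
    (subst₂ (λ q r → Linked B p (pos q) r k) e₁ e₂
      (linked-stable agree (≤-trans X≤x (<⇒≤ (<-trans x<p (proj₂ e)))) c))

  rank : (ℕ → ℕ) → ℕ → ℕ
  rank t v = sumTo n (λ k → 𝟙 (v <? t (suc k)))

  rank≤n : ∀ t v → rank t v ≤ n
  rank≤n t v = ≤-trans (sumTo-bound n (λ k → 𝟙≤1 (v <? t (suc k)))) (≤-reflexive (*-identityʳ n))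

  rank-antitone : ∀ t {u v} → u ≤ v → rank t v ≤ rank t u
  rank-antitone t u≤v = sumTo-mono n λ k → 𝟙-mono (_ <? t (suc k)) (_ <? t (suc k)) (≤-<-trans u≤v)

  -- Quantifying over every lo below the top expresses maximality: `lo < A top (suc k)` holds
  -- exactly when some chain of `suc k` edges starts above lo, and one stored chain witnesses it for
  -- all these lo.
  record Tops (X : ℕ) (A : Arrays) : Set where
    field
      sound    : lo < A top (suc k) → Linked A lo X (A node (suc k)) (suc k)
      complete : Chain lo X (suc k) → lo < A top (suc k)
      node-0   : A node 0 ≡ 0

    private
      -- Dropping the last edge keeps the first one, so the tops do not increase with the level.
      closed : ∀ v k → v < A top (suc (suc k)) → v < A top (suc k)
      closed v k = complete ∘ chain-init ∘ linked⇒chain ∘ sound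

    rank-complete : Chain v X k → k ≤ rank (A top) v
    rank-complete {k = zero}      c = z≤n
    rank-complete {v} {k = suc k} c = holds⇒<count (λ k → v <? A top (suc k)) (closed v)
      (≤-trans (m≤n+m (suc k) v) (chain-length c)) (complete c)

    rank-sound : ∀ v → Linked A v X (A node (rank (A top) v)) (rank (A top) v)
    rank-sound v = go (rank (A top) v) refl
      where
      go : ∀ f → f ≡ rank (A top) v → Linked A v X (A node f) f
      go zero    _  = subst (λ r → Linked A v X r 0) (sym node-0) []
      go (suc f) f≡ = sound (<count⇒holds (λ k → v <? A top (suc k)) (closed v) {n} (≤-reflexive f≡))

    rank-head : rank (A top) (suc n) ≡ 0
    rank-head with rank (A top) (suc n) | rank-sound (suc n)
    ... | zero  | _ = refl
    ... | suc f | l = contradiction (chain-length (linked⇒chain l)) (<⇒≱ (s≤s (m≤m+n n (suc f))))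

  -- The order on the edges of v is lexicographic: first the length of the continuation, then the
  -- lower vertex.
  record CandidateAt (X : ℕ) (A : Arrays) (v l q r : ℕ) : Set where
    field
      sound    : (q ≡ 0 × l ≡ 0) ⊎ (X < pos q × q < v × Linked A v (pos q) r l)
      complete : ∀ {u k} → u < v → X < pos u → Chain v (pos u) k → k < l ⊎ (k ≡ l × u ≤ q)

  Candidate : ℕ → Arrays → ℕ → Set
  Candidate X A v = CandidateAt X A v (A level v) (A partner v) (A next v)

  candidate-cong : ∀ {l l′ q q′ r r′} → l ≡ l′ → q ≡ q′ → r ≡ r′ →
                   CandidateAt X A v l q r → CandidateAt X A v l′ q′ r′
  candidate-cong refl refl refl c = c

  candidate-stable : ∀ {l q r} → Agree X A B → CandidateAt X A v l q r → CandidateAt X B v l q r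
  candidate-stable agree c = record
    { sound    = [ inj₁ , (λ (X<q , q<v , c) → inj₂ (X<q , q<v , linked-stable agree (<⇒≤ X<q) c)) ]′ sound
    ; complete = complete
    }
    where open CandidateAt c

  candidate-level≤n : Candidate X A v → A level v ≤ n
  candidate-level≤n {X} {A} {v} c with A level v | CandidateAt.sound c
  ... | l     | inj₁ (_ , refl)     = z≤n
  ... | zero  | inj₂ _              = z≤n
  ... | suc l | inj₂ (_ , _ , link) = ≤-trans (m≤n+m (suc l) v) (chain-length (linked⇒chain link))

  -- `gap<` guarantees that the subtractions do not truncate. By `count`, adding the marks met on
  -- the way down keeps the accumulator equal to the rank of the current value.
  record LinkAt (X : ℕ) (t : ℕ → ℕ) (y g m : ℕ) : Set where
    field
      gap<      : g < y
      prev-free : pos (y ∸ g ∸ 1) ≤ X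
      between   : y ∸ g ∸ 1 < v → v < y → X < pos v
      count     : rank t y + m ≡ rank t (y ∸ g ∸ 1)

    prev< : y ∸ g ∸ 1 < y
    prev< = <-≤-trans (∸-monoʳ-< {o = 0} z<s (m<n⇒0<n∸m gap<)) (m∸n≤m y g)

    m≤n : m ≤ n
    m≤n = ≤-trans (m≤n+m m (rank t y)) (≤-trans (≤-reflexive count) (rank≤n t _))

  Link : ℕ → Arrays → ℕ → Set
  Link X A y = LinkAt X (A top) y (A gap y) (A marks y)

  -- Flags and list are those of the positions beyond X, the tops those of the positions beyond Y.
  record Base (X Y : ℕ) (A : Arrays) : Set where
    field
      flag-yes : X < pos v → A seen v ≡ 1
      flag-no  : pos v ≤ X → A seen v ≡ 0
      link     : 0 < y → y ≤ suc n → pos y ≤ X → Link X A y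
      marks-0  : A marks 0 ≡ 0
      tops     : Tops Y A

  record Inv (X : ℕ) (A : Arrays) : Set where
    field
      base       : Base X X A
      candidates : 0 < pos v → pos v ≤ X → Candidate X A v

  -- Zero gaps link every value to its predecessor and zero tops stand for absent chains, so zeroed
  -- memory is already a valid start.
  inv-initial : Inv n (λ _ _ → 0)
  inv-initial = record
    { base = record
      { flag-yes = λ n<v → contradiction (pos≤n _) (<⇒≱ n<v)
      ; flag-no  = λ _ → refl
      ; link     = λ { {suc y} _ _ _ → record
        { gap<      = z<s
        ; prev-free = pos≤n _
        ; between   = λ y<v v<1+y → contradiction (s≤s⁻¹ v<1+y) (<⇒≱ y<v)
        ; count     = trans (+-identityʳ _) (trans (rank-0 (suc y)) (sym (rank-0 y)))
        } }
      ; marks-0  = refl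
      ; tops     = record
        { sound    = λ ()
        ; complete = λ { (cons _ n<p _ _) → contradiction (pos≤n _) (<⇒≱ n<p) }
        ; node-0   = refl
        }
      }
    ; candidates = λ _ _ → record
      { sound    = inj₁ (refl , refl)
      ; complete = λ _ n<u → contradiction (pos≤n _) (<⇒≱ n<u)
      }
    }
    where
    rank-0 : ∀ v → rank (λ _ → 0) v ≡ 0
    rank-0 v = trans (sumTo-cong n (λ k _ → 𝟙-no (v <? 0) λ ())) (sumTo-0 n)

  -- The downward walk for an entering lower vertex

  record Progress (x y : ℕ) (A : Arrays) : Set where
    field
      base : Base (suc x) (suc x) A
      todo : 0 < pos v → pos v ≤ suc x → v < y → Candidate (suc x) A v
      done : 0 < pos v → pos v ≤ x → y ≤ v → Candidate x A v

  progress-start : Inv (suc x) A → Progress x (suc n) A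
  progress-start i = record
    { base = base
    ; todo = λ 0<v v≤ _ → candidates 0<v v≤
    ; done = λ 0<v _ n<v → contradiction (proj₂ (in-range 0<v)) (<⇒≱ n<v)
    }
    where open Inv i

  offered : Arrays → ℕ → ℕ → ℕ → Arrays
  offered A v f p = put (put (put A level v f) partner v p) next v (A node f)

  offered-agree : ∀ A v f p → pos v ≤ X → Agree X A (offered A v f p)
  offered-agree A v f p v≤X {u} X<u = sym (↦-other (A partner) u≢v) , sym (↦-other (A next) u≢v)
    where
    u≢v : u ≢ v
    u≢v refl = <⇒≱ X<u v≤X

  tops-stable : Agree X A B → (∀ k → B top k ≡ A top k) → (∀ k → B node k ≡ A node k) →
                Tops X A → Tops X B
  tops-stable {X} {A} {B} agree same-top same-node t = record
    { sound    = λ {lo} {k} lo< → linked-stable {A = A} {B = B} agree ≤-refl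
        (subst (λ r → Linked A lo X r (suc k)) (sym (same-node (suc k))) (sound (subst (_ <_) (same-top _) lo<)))
    ; complete = λ c → subst (_ <_) (sym (same-top _)) (complete c)
    ; node-0   = trans (same-node 0) node-0
    }
    where open Tops t

  module _ {x y A p} (progress : Progress x y A) (y>0 : 0 < y) (y≤ : y ≤ suc n) (y-free : pos y ≤ suc x)
           (p≡ : pos p ≡ suc x) where
    open Progress progress
    open Base base
    open Tops tops

    private
      v′ f′ : ℕ
      v′ = prev A y
      f′ = rank (A top) v′
      module L = LinkAt (link y>0 y≤ y-free)

    module _ (p<v : p < v′) where

      v-positive : 0 < pos v′
      v-positive = pos-positive (≤-<-trans z≤n p<v) (s≤s⁻¹ (<-≤-trans L.prev< y≤))

      private
        v-free : pos v′ ≤ x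
        v-free = free-below p≡ (≢-sym (<⇒≢ p<v)) L.prev-free

        open CandidateAt (todo v-positive L.prev-free L.prev<)
          renaming (sound to old-sound; complete to old-complete)

        cut : ∀ {P : Set} → v′ ≤ u → pos u ≤ suc x → (u ≡ v′ → P) → (y ≤ u → P) → P
        cut {u} v≤u u-free at above with u ≟ v′ | y ≤? u
        ... | yes u≡v | _       = at u≡v
        ... | no _    | yes y≤u = above y≤u
        ... | no u≢v′  | no y≰u  =
          contradiction u-free (<⇒≱ (L.between (≤∧≢⇒< v≤u (≢-sym u≢v′)) (≰⇒> y≰u)))

        -- Lower vertices enter at decreasing positions, so every continuation open to an earlier
        -- partner of `v′` is open to p too.
        level≤f : A level v′ ≤ f′
        level≤f with old-sound
        ... | inj₁ (_ , l≡0)     = ≤-trans (≤-reflexive l≡0) z≤n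
        ... | inj₂ (X<q , _ , c) = rank-complete (linked⇒chain (linked-weaken ≤-refl (<⇒≤ X<q) c))

        new : ∀ {u k} → pos u ≡ suc x → Chain v′ (pos u) k → u ≡ p × k ≤ f′
        new u≡ c = pos-injective (subst (0 <_) (sym u≡) z<s) (trans u≡ (sym p≡)) ,
                   rank-complete (chain-weaken ≤-refl (≤-reflexive (sym u≡)) c)

      progress-skip : ¬ A level v′ < f′ → ¬ A partner v′ < p → Progress x v′ A
      progress-skip l≮f′ q≮p = record
        { base = base
        ; todo = λ 0<u u-free u<v → todo 0<u u-free (<-trans u<v L.prev<)
        ; done = λ 0<u u-free v≤u → cut v≤u (m≤n⇒m≤1+n u-free)
            (λ { refl → record { sound = weaken old-sound ; complete = complete′ } })
            (done 0<u u-free)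
        }
        where
        weaken = [ inj₁ , (λ (X<q , rest) → inj₂ (<⇒≤ X<q , rest)) ]′

        complete′ : ∀ {u k} → u < v′ → x < pos u → Chain v′ (pos u) k →
                    k < A level v′ ⊎ (k ≡ A level v′ × u ≤ A partner v′)
        complete′ {u} {k} u<v x<u c with pos u ≟ suc x
        ... | no u≢ = old-complete u<v (≤∧≢⇒< x<u (≢-sym u≢)) c
        ... | yes u≡ with new u≡ c
        ...   | refl , k≤f with k ≟ A level v′
        ...     | yes k≡l = inj₂ (k≡l , ≮⇒≥ q≮p)
        ...     | no k≢l  = inj₁ (≤∧≢⇒< (≤-trans k≤f (≮⇒≥ l≮f′)) k≢l)

      progress-offer : A level v′ < f′ ⊎ A partner v′ < p → Progress x v′ (offered A v′ f′ p)
      progress-offer better = record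
        { base = record { Base base ; tops = tops-stable agree (λ _ → refl) (λ _ → refl) tops }
        ; todo = λ 0<u u-free u<v → elsewhere (<⇒≢ u<v) agree (todo 0<u u-free (<-trans u<v L.prev<))
        ; done = λ {u} 0<u u-free v≤u → cut v≤u (m≤n⇒m≤1+n u-free)
            (λ { refl → candidate-cong
                  (sym (↦-same (A level) v′)) (sym (↦-same (A partner) v′)) (sym (↦-same (A next) v′))
                  (record { sound = inj₂ (≤-reflexive (sym p≡) , p<v ,
                              linked-stable agree (≤-reflexive (sym p≡))
                                (linked-weaken ≤-refl (≤-reflexive p≡) (rank-sound v′)))
                          ; complete = complete′ better }) })
            (λ y≤u → elsewhere (≢-sym (<⇒≢ (<-≤-trans L.prev< y≤u))) agree-x (done 0<u u-free y≤u))
        }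
        where
        agree : Agree (suc x) A (offered A v′ f′ p)
        agree = offered-agree A v′ f′ p L.prev-free

        agree-x : Agree x A (offered A v′ f′ p)
        agree-x = offered-agree A v′ f′ p v-free

        elsewhere : u ≢ v′ → Agree X A (offered A v′ f′ p) → Candidate X A u → Candidate X (offered A v′ f′ p) u
        elsewhere u≢v′ agree c = candidate-stable agree
          (candidate-cong (sym (↦-other (A level) u≢v′)) (sym (↦-other (A partner) u≢v′))
                          (sym (↦-other (A next) u≢v′)) c)

        complete′ : A level v′ < f′ ⊎ A partner v′ < p → ∀ {u k} → u < v′ → x < pos u →
                    Chain v′ (pos u) k → k < f′ ⊎ (k ≡ f′ × u ≤ p)
        complete′ better {u} {k} u<v x<u c with pos u ≟ suc x
        ... | yes u≡ with new u≡ c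
        ...   | refl , k≤f with k ≟ f′
        ...     | yes k≡f = inj₂ (k≡f , ≤-refl)
        ...     | no k≢f′  = inj₁ (≤∧≢⇒< k≤f k≢f′)
        complete′ better {u} {k} u<v x<u c | no u≢ with better | old-complete u<v (≤∧≢⇒< x<u (≢-sym u≢)) c
        ... | _        | inj₁ k<l          = inj₁ (<-≤-trans k<l level≤f)
        ... | inj₁ l<f | inj₂ (refl , _)   = inj₁ l<f
        ... | inj₂ q<p | inj₂ (refl , u≤q) with A level v′ ≟ f′
        ...   | yes l≡f = inj₂ (l≡f , ≤-trans u≤q (<⇒≤ q<p))
        ...   | no l≢f′  = inj₁ (≤∧≢⇒< level≤f l≢f′)

  -- The unswept value z is the one whose gap contains q. If q itself is unswept, as the missing top
  -- 0 is, then z is q.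
  record Owner (X q z : ℕ) : Set where
    field
      q≤z     : q ≤ z
      z-free  : pos z ≤ X
      all-set : q ≤ u → u < z → X < pos u

  -- Stepping from y to the unswept value below it changes whether q lies strictly above only if q
  -- is in the gap of y, and that happens for the owner alone.
  owner-gap : ∀ {t g m} → LinkAt X t y g m → pos y ≤ X → Owner X q z →
              𝟙 (y ∸ g ∸ 1 <? q) ≡ 𝟙 (y <? q) + 𝟙 (y ≟ z)
  owner-gap {X} {y} {q} {z} {t} {g} link y-free owner = go (y ≟ z) (y <? q)
    where
    open LinkAt link
    open Owner owner

    go : Dec (y ≡ z) → Dec (y < q) → 𝟙 (y ∸ g ∸ 1 <? q) ≡ 𝟙 (y <? q) + 𝟙 (y ≟ z)
    go (yes refl) _ = trans
      (𝟙-yes (_ <? q) (≰⇒> λ q≤v → <⇒≱ (all-set q≤v prev<) prev-free))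
      (sym (cong₂ _+_ (𝟙-no (y <? q) (≤⇒≯ q≤z)) (𝟙-yes (y ≟ y) refl)))
    go (no y≢z) (yes y<q) = trans
      (𝟙-yes (_ <? q) (<-trans prev< y<q))
      (sym (cong₂ _+_ (𝟙-yes (y <? q) y<q) (𝟙-no (y ≟ z) y≢z)))
    go (no y≢z) (no y≮q) = trans
      (𝟙-no (_ <? q) (≤⇒≯ (≤-trans q≤z (≮⇒≥ λ v<z → <⇒≱ (between v<z z<y) z-free))))
      (sym (cong₂ _+_ (𝟙-no (y <? q) y≮q) (𝟙-no (y ≟ z) y≢z)))
      where
      z<y : z < y
      z<y = ≤∧≢⇒< (≮⇒≥ λ y<z → <⇒≱ (all-set (≮⇒≥ y≮q) y<z) y-free) (≢-sym y≢z)

  incremented decremented : (ℕ → ℕ) → ℕ → ℕ → ℕ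
  incremented m z = m [ z ↦ suc (m z) ]
  decremented m z = m [ z ↦ m z ∸ 1 ]

  incremented-𝟙 : ∀ m z y → incremented m z y ≡ m y + 𝟙 (y ≟ z)
  incremented-𝟙 m z y = go (y ≟ z)
    where
    go : Dec (y ≡ z) → incremented m z y ≡ m y + 𝟙 (y ≟ z)
    go (yes refl) = trans (↦-same m y) (trans (+-comm 1 (m y)) (cong (m y +_) (sym (𝟙-yes (y ≟ y) refl))))
    go (no y≢z)   = trans (↦-other m y≢z) (trans (sym (+-identityʳ (m y))) (cong (m y +_) (sym (𝟙-no (y ≟ z) y≢z))))

  decremented-𝟙 : ∀ m z y → decremented m z y ≡ m y ∸ 𝟙 (y ≟ z)
  decremented-𝟙 m z y = go (y ≟ z)
    where
    go : Dec (y ≡ z) → decremented m z y ≡ m y ∸ 𝟙 (y ≟ z)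
    go (yes refl) = trans (↦-same m y) (cong (m y ∸_) (sym (𝟙-yes (y ≟ y) refl)))
    go (no y≢z)   = trans (↦-other m y≢z) (cong (m y ∸_) (sym (𝟙-no (y ≟ z) y≢z)))

  rank-update : ∀ t q v → k < n →
                rank (t [ suc k ↦ q ]) v + 𝟙 (v <? t (suc k)) ≡ rank t v + 𝟙 (v <? q)
  rank-update {k} t q v k<n =
    subst (λ a → rank (t [ suc k ↦ q ]) v + 𝟙 (v <? t (suc k)) ≡ rank t v + 𝟙 (v <? a))
      (↦-same t (suc k))
      (sumTo-update n k k<n λ i i≢k → cong (λ a → 𝟙 (v <? a)) (↦-other t (i≢k ∘ suc-injective)))

  -- A new top changes the ranks at both ends of a gap. By `owner-gap` the two changes cancel except
  -- at the owners of the new and the old top, so two marks are corrected and all others stand.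
  raised-link : ∀ {t g m z₁ z₂} → k < n → t (suc k) < q → pos y ≤ X →
                Owner X q z₁ → Owner X (t (suc k)) z₂ →
                LinkAt X t y g (m y) →
                LinkAt X (t [ suc k ↦ q ]) y g (decremented (incremented m z₁) z₂ y)
  raised-link {k} {q} {y} {X} {t} {g} {m} {z₁} {z₂} k<n o<q y-free owner₁ owner₂ link = record
    { LinkAt link
    ; count = trans (cong (a +_) (trans (decremented-𝟙 (incremented m z₁) z₂ y)
                                        (cong (_∸ j₂) (incremented-𝟙 m z₁ y))))
                (trans (sym (+-∸-assoc a j₂≤)) (trans (cong (_∸ j₂) (sym balance)) (m+n∸n≡m a′ j₂)))
    }
    where
    open LinkAt link
    y′ = y ∸ g ∸ 1
    o = t (suc k)
    t′ = t [ suc k ↦ q ]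
    a  = rank t′ y
    a′ = rank t′ y′
    j₁ = 𝟙 (y ≟ z₁)
    j₂ = 𝟙 (y ≟ z₂)

    balance : a′ + j₂ ≡ a + (m y + j₁)
    balance = +-cancelʳ-≡ (𝟙 (y <? o)) _ _ (begin
      (a′ + j₂) + 𝟙 (y <? o)                   ≡⟨ shuffle₁ a′ j₂ _ ⟩
      a′ + (𝟙 (y <? o) + j₂)                   ≡⟨ cong (a′ +_) (owner-gap link y-free owner₂) ⟨
      a′ + 𝟙 (y′ <? o)                          ≡⟨ rank-update t q y′ k<n ⟩
      rank t y′ + 𝟙 (y′ <? q)                    ≡⟨ cong₂ _+_ (sym count) (owner-gap link y-free owner₁) ⟩
      (rank t y + m y) + (𝟙 (y <? q) + j₁)     ≡⟨ interchange′ (rank t y) (m y) _ j₁ ⟩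
      (rank t y + 𝟙 (y <? q)) + (m y + j₁)     ≡⟨ cong (_+ (m y + j₁)) (rank-update t q y k<n) ⟨
      (a + 𝟙 (y <? o)) + (m y + j₁)            ≡⟨ shuffle₂ a _ (m y + j₁) ⟩
      (a + (m y + j₁)) + 𝟙 (y <? o)            ∎)
      where
      open ≡-Reasoning
      shuffle₁ : ∀ a b c → (a + b) + c ≡ a + (c + b)
      shuffle₁ = solve-∀
      shuffle₂ : ∀ a b c → (a + b) + c ≡ (a + c) + b
      shuffle₂ = solve-∀
      interchange′ : ∀ a b c d → (a + b) + (c + d) ≡ (a + c) + (b + d)
      interchange′ = solve-∀

    -- The decrement does not truncate: ranks do not increase with the value, so `balance` leaves at
    -- least `j₂` on the right.
    j₂≤ : j₂ ≤ m y + j₁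
    j₂≤ = +-cancelˡ-≤ a _ _ (≤-trans (+-monoˡ-≤ j₂ (rank-antitone t′ (<⇒≤ prev<))) (≤-reflexive balance))

  -- Both tops may lie in the same gap, so the decrement acts on the count after the increment.
  raised : Arrays → ℕ → ℕ → ℕ → Arrays
  raised A p z₁ z₂ =
    put (put (put (put A marks z₁ (suc (A marks z₁)))
                  marks z₂ (incremented (A marks) z₁ z₂ ∸ 1))
             top (suc (A level p)) (A partner p))
        node (suc (A level p)) p

  module _ {x A p} (base : Base (suc x) (suc x) A) (cand : Candidate (suc x) A p) (p≡ : pos p ≡ suc x) where
    open Base base
    open Tops tops renaming (sound to top-sound; complete to top-complete)
    open CandidateAt cand renaming (sound to cand-sound; complete to cand-complete)

    -- A chain new at this position begins with an edge `(q₁ , p)`. If its continuation is shorter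
    -- than `level p`, the stored continuation, truncated to `suc k` edges, starts above p and so
    -- above `q₁`: the old top suffices. If it has length `level p`, then `q₁` is at most
    -- `partner p`.
    advance : ∀ (t : ℕ → ℕ) → (∀ k → A top k ≤ t k) → A partner p ≤ t (suc (A level p)) →
              Chain lo x (suc k) → lo < t (suc k)
    advance {lo = lo} {k = k} t A≤t p≤t (cons {q₁} {p₁} lo< x<p₁ (q₁<p₁ , e) c) with pos p₁ ≟ suc x
    ... | no p₁≢ = <-≤-trans (top-complete (cons lo< (≤∧≢⇒< x<p₁ (≢-sym p₁≢)) (q₁<p₁ , e) c)) (A≤t (suc k))
    ... | yes p₁≡ with pos-injective (subst (0 <_) (sym p₁≡) z<s) (trans p₁≡ (sym p≡))
    ...   | refl with cand-complete q₁<p₁ (subst (_< pos q₁) p₁≡ e) c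
    ...     | inj₂ (refl , q₁≤) = <-≤-trans lo< (≤-trans q₁≤ p≤t)
    ...     | inj₁ k< with cand-sound
    ...       | inj₁ (_ , l≡0) = contradiction (subst (k <_) l≡0 k<) λ ()
    ...       | inj₂ (X<q , _ , link) =
      <-trans lo< (<-trans q₁<p₁ (<-≤-trans
        (top-complete (truncate k< (chain-weaken ≤-refl (<⇒≤ X<q) (linked⇒chain link))))
        (A≤t (suc k))))
      where
      truncate : ∀ {l} → k < l → Chain p (suc x) l → Chain p (suc x) (suc k)
      truncate {suc l} k<l c with suc k ≟ suc l
      ... | yes refl = c
      ... | no k≢l   = truncate (≤∧≢⇒< (s≤s⁻¹ k<l) (k≢l ∘ cong suc)) (chain-init c)

    base-keep : ¬ A top (suc (A level p)) < A partner p → Base (suc x) x A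
    base-keep o≮q = record
      { Base base
      ; tops = record
        { sound    = linked-weaken ≤-refl (n≤1+n x) ∘ top-sound
        ; complete = advance (A top) (λ _ → ≤-refl) (≮⇒≥ o≮q)
        ; node-0   = node-0
        }
      }

    base-raise : ∀ {z₁ z₂} → A top (suc (A level p)) < A partner p →
                 Owner (suc x) (A partner p) z₁ → Owner (suc x) (A top (suc (A level p))) z₂ →
                 Base (suc x) x (raised A p z₁ z₂)
    base-raise {z₁} {z₂} o<q owner₁ owner₂ with cand-sound
    ... | inj₁ (q≡0 , _) = contradiction (≤-trans (s≤s z≤n) o<q) (<-irrefl (sym q≡0))
    ... | inj₂ (X<q , q<p , link-p) = record
      { flag-yes = flag-yes
      ; flag-no  = flag-no
      ; link     = λ 0<y y≤ y-free → raised-link l<n o<q y-free owner₁ owner₂ (link 0<y y≤ y-free)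
      -- An absent old top is 0 and is owned by 0. Truncated subtraction keeps the mark there at 0,
      -- so the program treats this case like any other.
      ; marks-0  = trans (decremented-𝟙 (incremented (A marks) z₁) z₂ 0)
                     (trans (cong (_∸ 𝟙 (0 ≟ z₂)) (trans (incremented-𝟙 (A marks) z₁ 0)
                       (cong₂ _+_ marks-0 (𝟙-no (0 ≟ z₁) (<⇒≢ (<-≤-trans (≤-<-trans z≤n o<q) (Owner.q≤z owner₁)))))))
                       (0∸n≡0 (𝟙 (0 ≟ z₂))))
      ; tops     = record
        { sound    = λ {lo} {k} → linked-stable {A = A} (λ _ → refl , refl) ≤-refl ∘ sound′ {lo} {k}
        ; complete = advance (A top [ w ↦ A partner p ]) grows (≤-reflexive (sym (↦-same (A top) w)))
        ; node-0   = trans (↦-other (A node) {w} {0} {p} λ ()) node-0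
        }
      }
      where
      w = suc (A level p)

      chain-p : ∀ {lo} → lo < A partner p → Linked A lo x p w
      chain-p lo<q = cons lo<q (≤-reflexive (sym p≡)) (q<p , subst (_< pos (A partner p)) (sym p≡) X<q) link-p

      l<n : A level p < n
      l<n = chain-length (linked⇒chain (chain-p (≤-<-trans z≤n o<q)))

      sound′ : ∀ {lo k} → lo < (A top [ w ↦ A partner p ]) (suc k) →
               Linked A lo x ((A node [ w ↦ p ]) (suc k)) (suc k)
      sound′ {k = k} lo< with suc k ≟ w
      ... | yes refl = chain-p lo<
      ... | no _     = linked-weaken ≤-refl (n≤1+n x) (top-sound lo<)

      grows : ∀ k → A top k ≤ (A top [ w ↦ A partner p ]) k
      grows k with k ≟ w
      ... | yes refl = <⇒≤ o<q
      ... | no _     = ≤-refl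

  -- A value below p cannot have p as its lower neighbour, so the remaining candidates are already
  -- right and the walk may stop at p.
  progress-end : ∀ {x y A p} → Progress x y A → 0 < y → y ≤ suc n → pos y ≤ suc x → pos p ≡ suc x →
                 prev A y ≡ p → 0 < pos v → pos v ≤ x → Candidate x A v
  progress-end {v} {x} {y} {A} {p} progress 0<y y≤ y-free p≡ refl 0<v v-free with y ≤? v
  ... | yes y≤v = Progress.done progress 0<v v-free y≤v
  ... | no y≰v  = record
    { sound    = [ inj₁ , (λ (X<q , rest) → inj₂ (<⇒≤ X<q , rest)) ]′ old-sound
    ; complete = λ {u} u<v x<u → old-complete u<v
        (≤∧≢⇒< x<u λ x≡u → <⇒≢ (<-≤-trans u<v v≤p)
          (pos-injective (subst (0 <_) x≡u z<s) (trans (sym x≡u) (sym p≡))))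
    }
    where
    open LinkAt (Base.link (Progress.base progress) 0<y y≤ y-free)
    open CandidateAt (Progress.todo progress 0<v (m≤n⇒m≤1+n v-free) (≰⇒> y≰v))
      renaming (sound to old-sound; complete to old-complete)

    v≤p : v ≤ p
    v≤p = ≮⇒≥ λ p<v → <⇒≱ (between p<v (≰⇒> y≰v)) (m≤n⇒m≤1+n v-free)

  -- Removing the entered value from the list of unswept values

  merged : Arrays → ℕ → ℕ → Arrays
  merged A s p = put (put (put A gap s (A gap s + (A gap p + 1)))
                          marks s (A marks s + A marks p))
                     seen p 1

  inv-merge : ∀ {x s A p} → Base (suc x) x A → (∀ {v} → 0 < pos v → pos v ≤ x → Candidate x A v) →
              0 < s → s ≤ suc n → pos s ≤ suc x → pos p ≡ suc x → prev A s ≡ p →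
              Inv x (merged A s p)
  inv-merge {x} {s} {A} {p} base candidates 0<s s≤ s-free p≡ refl = record
    { base = record
      { flag-yes = flag-yes′
      ; flag-no  = flag-no′
      ; link     = link′
      ; marks-0  = trans (↦-other (A marks) (<⇒≢ 0<s)) marks-0
      ; tops     = tops-stable {A = A} (λ _ → refl , refl) (λ _ → refl) (λ _ → refl) tops
      }
    ; candidates = λ 0<v v-free → candidate-stable {A = A} (λ _ → refl , refl) (candidates 0<v v-free)
    }
    where
    open Base base
    module S = LinkAt (link 0<s s≤ s-free)

    0<p : 0 < pos p
    0<p = subst (0 <_) (sym p≡) z<s

    module P = LinkAt (link (proj₁ (in-range 0<p)) (m≤n⇒m≤1+n (proj₂ (in-range 0<p))) (≤-reflexive p≡))

    flag-yes′ : x < pos v → (A seen [ p ↦ 1 ]) v ≡ 1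
    flag-yes′ {v} x<v with v ≟ p
    ... | yes _  = refl
    ... | no v≢p = flag-yes (≰⇒> λ v≤ → <⇒≱ x<v (free-below p≡ v≢p v≤))

    flag-no′ : pos v ≤ x → (A seen [ p ↦ 1 ]) v ≡ 0
    flag-no′ {v} v≤x with v ≟ p
    ... | yes refl = contradiction (subst (_≤ x) p≡ v≤x) 1+n≰n
    ... | no _     = flag-no (m≤n⇒m≤1+n v≤x)

    link′ : 0 < y → y ≤ suc n → pos y ≤ x → Link x (merged A s p) y
    link′ {y} 0<y y≤ y-free with y ≟ s
    ... | no y≢s = record
      { gap<      = gap<
      ; prev-free = free-below p≡ prev≢p prev-free
      ; between   = λ v< <y → <-trans (n<1+n x) (between v< <y)
      ; count     = count
      }
      where
      open LinkAt (link 0<y y≤ (m≤n⇒m≤1+n y-free))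

      -- If y and s both had p directly below them, the smaller of the two would lie in the gap of
      -- the larger, yet both are unswept.
      prev≢p : prev A y ≢ p
      prev≢p v≡p with y <? s
      ... | yes y<s = <⇒≱ (S.between (subst (_< y) v≡p prev<) y<s) (m≤n⇒m≤1+n y-free)
      ... | no y≮s  = <⇒≱ (between (subst (_< s) (sym v≡p) S.prev<) (≤∧≢⇒< (≮⇒≥ y≮s) (≢-sym y≢s))) s-free
    ... | yes refl = record
      { gap<      = gap<′
      ; prev-free = subst (λ v → pos v ≤ x) (sym prev≡) (free-below p≡ (<⇒≢ P.prev<) P.prev-free)
      ; between   = between′
      ; count     = trans (sym (+-assoc (rank (A top) s) _ _))
                      (trans (cong (_+ A marks p) S.count) (trans P.count (cong (rank (A top)) (sym prev≡))))
      }
      where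
      prev≡ : s ∸ (A gap s + (A gap p + 1)) ∸ 1 ≡ prev A p
      prev≡ = begin
        s ∸ (A gap s + (A gap p + 1)) ∸ 1  ≡⟨ cong (λ g → s ∸ g ∸ 1) (shift (A gap s) (A gap p)) ⟩
        s ∸ (A gap s + 1 + A gap p) ∸ 1    ≡⟨ cong (_∸ 1) (∸-+-assoc s (A gap s + 1) (A gap p)) ⟨
        s ∸ (A gap s + 1) ∸ A gap p ∸ 1    ≡⟨ cong (λ v → v ∸ A gap p ∸ 1) (∸-+-assoc s (A gap s) 1) ⟨
        p ∸ A gap p ∸ 1                    ∎
        where
        open ≡-Reasoning
        shift : ∀ a b → a + (b + 1) ≡ a + 1 + b
        shift = solve-∀

      gap<′ : A gap s + (A gap p + 1) < s
      gap<′ = begin-strict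
        A gap s + (A gap p + 1)  <⟨ +-monoʳ-< (A gap s) (+-monoˡ-< 1 P.gap<) ⟩
        A gap s + (p + 1)        ≡⟨ cong (A gap s +_) (m∸n+n≡m (m<n⇒0<n∸m S.gap<)) ⟩
        A gap s + (s ∸ A gap s)  ≡⟨ m+[n∸m]≡n (<⇒≤ S.gap<) ⟩
        s                        ∎
        where open ≤-Reasoning

      between′ : s ∸ (A gap s + (A gap p + 1)) ∸ 1 < v → v < s → x < pos v
      between′ {v} <v v<s with v ≟ p
      ... | yes refl = ≤-reflexive (sym p≡)
      ... | no v≢p with v <? p
      ...   | yes v<p = <-trans (n<1+n x) (P.between (subst (_< v) prev≡ <v) v<p)
      ...   | no v≮p  = <-trans (n<1+n x) (S.between (≤∧≢⇒< (≮⇒≥ v≮p) (≢-sym v≢p)) v<s)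

  pos-head : pos (suc n) ≡ 0
  pos-head with pos (suc n) in eq
  ... | zero  = refl
  ... | suc _ = contradiction (proj₂ (in-range (subst (0 <_) (sym eq) z<s))) 1+n≰n

  module _ (inv : Inv 0 A) where
    open Inv inv
    open Base base
    open Tops tops

    private
      open LinkAt (link {suc n} z<s ≤-refl (≤-reflexive pos-head))

      prev≡0 : prev A (suc n) ≡ 0
      prev≡0 with prev A (suc n) in eq
      ... | zero  = refl
      ... | suc v = contradiction
        (pos-positive {suc v} z<s (s≤s⁻¹ (subst (_< suc n) eq prev<)))
        (≤⇒≯ (subst (λ v → pos v ≤ 0) eq prev-free))

      marks≡ : A marks (suc n) ≡ rank (A top) 0
      marks≡ = trans (cong (_+ A marks (suc n)) (sym rank-head)) (trans count (cong (rank (A top)) prev≡0))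

    -- With every position swept, the gap of `suc n` contains all of 1, ..., n. Its mark is the rank
    -- of 0, the length of a longest chain.
    final-linked : Linked A 0 0 (A node (A marks (suc n))) (A marks (suc n))
    final-linked = subst (λ k → Linked A 0 0 (A node k) k) (sym marks≡) (rank-sound 0)

    final-maximum : Chain 0 0 k → k ≤ A marks (suc n)
    final-maximum c = ≤-trans (rank-complete c) (≤-reflexive (sym marks≡))

-- The program on the random access machine

zeroʳ oneʳ eightʳ lenʳ xʳ pʳ vʳ accʳ vOffʳ addrʳ tmpʳ offʳ qʳ oʳ wʳ zʳ pOffʳ : Reg
zeroʳ  = 0
oneʳ   = 1
eightʳ = 2
lenʳ   = 3
xʳ     = 12
pʳ     = 13
vʳ     = 14
accʳ   = 15
vOffʳ  = 16
addrʳ  = 17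
tmpʳ   = 18
offʳ   = 19
qʳ     = 20
oʳ     = 21
wʳ     = 22
zʳ     = 23
pOffʳ  = 24

baseʳ : Field → Reg
baseʳ f = 4 + f

program : Program
program =
    load lenʳ zeroʳ
  ∷ const oneʳ 1
  ∷ const eightʳ 8
  ∷ arith add (baseʳ seen) lenʳ oneʳ
  ∷ arith add (baseʳ gap) (baseʳ seen) oneʳ
  ∷ arith add (baseʳ marks) (baseʳ gap) oneʳ
  ∷ arith add (baseʳ level) (baseʳ marks) oneʳ
  ∷ arith add (baseʳ partner) (baseʳ level) oneʳ
  ∷ arith add (baseʳ next) (baseʳ partner) oneʳ
  ∷ arith add (baseʳ top) (baseʳ next) oneʳ
  ∷ arith add (baseʳ node) (baseʳ top) oneʳ
  ∷ move xʳ lenʳ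
  -- 12: next position
  ∷ jeq xʳ zeroʳ 97
  ∷ load pʳ xʳ
  ∷ arith mul pOffʳ pʳ eightʳ
  -- The field `seen` starts at address `suc n`, so its base register also supplies the head of the
  -- list.
  ∷ move vʳ (baseʳ seen)
  ∷ move accʳ zeroʳ
  -- 17: next unseen value above p
  ∷ arith mul vOffʳ vʳ eightʳ
  ∷ arith add addrʳ vOffʳ (baseʳ marks)
  ∷ load tmpʳ addrʳ
  ∷ arith add accʳ accʳ tmpʳ
  ∷ arith add addrʳ vOffʳ (baseʳ gap)
  ∷ load tmpʳ addrʳ
  ∷ arith sub vʳ vʳ tmpʳ
  ∷ arith sub vʳ vʳ oneʳ
  ∷ jeq vʳ pʳ 44
  ∷ arith mul offʳ vʳ eightʳ
  ∷ arith add addrʳ offʳ (baseʳ level)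
  ∷ load tmpʳ addrʳ
  ∷ jlt tmpʳ accʳ 34
  ∷ arith add addrʳ offʳ (baseʳ partner)
  ∷ load tmpʳ addrʳ
  ∷ jlt tmpʳ pʳ 34
  ∷ jump 17
  -- 34: p becomes the partner of v
  ∷ arith add addrʳ offʳ (baseʳ level)
  ∷ store addrʳ accʳ
  ∷ arith add addrʳ offʳ (baseʳ partner)
  ∷ store addrʳ pʳ
  ∷ arith mul tmpʳ accʳ eightʳ
  ∷ arith add addrʳ tmpʳ (baseʳ node)
  ∷ load tmpʳ addrʳ
  ∷ arith add addrʳ offʳ (baseʳ next)
  ∷ store addrʳ tmpʳ
  ∷ jump 17
  -- 44: compare the best edge with upper vertex p to the top of its level
  ∷ arith add addrʳ pOffʳ (baseʳ level)
  ∷ load wʳ addrʳ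
  ∷ arith add wʳ wʳ oneʳ
  ∷ arith add addrʳ pOffʳ (baseʳ partner)
  ∷ load qʳ addrʳ
  ∷ arith mul offʳ wʳ eightʳ
  ∷ arith add addrʳ offʳ (baseʳ top)
  ∷ load oʳ addrʳ
  ∷ jlt oʳ qʳ 54
  ∷ jump 80
  ∷ move zʳ qʳ
  -- 55: find the gap of the new top
  ∷ arith mul tmpʳ zʳ eightʳ
  ∷ arith add addrʳ tmpʳ (baseʳ seen)
  ∷ load addrʳ addrʳ
  ∷ jeq addrʳ zeroʳ 61
  ∷ arith add zʳ zʳ oneʳ
  ∷ jump 55
  ∷ arith add addrʳ tmpʳ (baseʳ marks)
  ∷ load tmpʳ addrʳ
  ∷ arith add tmpʳ tmpʳ oneʳ
  ∷ store addrʳ tmpʳ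
  ∷ move zʳ oʳ
  -- 66: find the gap of the old top
  ∷ arith mul tmpʳ zʳ eightʳ
  ∷ arith add addrʳ tmpʳ (baseʳ seen)
  ∷ load addrʳ addrʳ
  ∷ jeq addrʳ zeroʳ 72
  ∷ arith add zʳ zʳ oneʳ
  ∷ jump 66
  ∷ arith add addrʳ tmpʳ (baseʳ marks)
  ∷ load tmpʳ addrʳ
  ∷ arith sub tmpʳ tmpʳ oneʳ
  ∷ store addrʳ tmpʳ
  ∷ arith add addrʳ offʳ (baseʳ top)
  ∷ store addrʳ qʳ
  ∷ arith add addrʳ offʳ (baseʳ node)
  ∷ store addrʳ pʳ
  -- 80: merge the gap of p into the gap above it
  ∷ arith add addrʳ pOffʳ (baseʳ gap)
  ∷ load tmpʳ addrʳ
  ∷ arith add tmpʳ tmpʳ oneʳ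
  ∷ arith add addrʳ vOffʳ (baseʳ gap)
  ∷ load qʳ addrʳ
  ∷ arith add tmpʳ qʳ tmpʳ
  ∷ store addrʳ tmpʳ
  ∷ arith add addrʳ pOffʳ (baseʳ marks)
  ∷ load tmpʳ addrʳ
  ∷ arith add addrʳ vOffʳ (baseʳ marks)
  ∷ load qʳ addrʳ
  ∷ arith add tmpʳ qʳ tmpʳ
  ∷ store addrʳ tmpʳ
  ∷ arith add addrʳ pOffʳ (baseʳ seen)
  ∷ store addrʳ oneʳ
  ∷ arith sub xʳ xʳ oneʳ
  ∷ jump 12
  -- 97: output
  ∷ arith mul vOffʳ (baseʳ seen) eightʳ
  ∷ arith add addrʳ vOffʳ (baseʳ marks)
  ∷ load tmpʳ addrʳ
  ∷ store zeroʳ tmpʳ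
  ∷ arith mul vOffʳ tmpʳ eightʳ
  ∷ arith add addrʳ vOffʳ (baseʳ node)
  ∷ load pʳ addrʳ
  ∷ move vʳ oneʳ
  -- 105: next edge of the chain
  ∷ jeq pʳ zeroʳ 116
  ∷ arith mul vOffʳ pʳ eightʳ
  ∷ arith add addrʳ vOffʳ (baseʳ partner)
  ∷ load tmpʳ addrʳ
  ∷ store vʳ tmpʳ
  ∷ arith add vʳ vʳ oneʳ
  ∷ store vʳ pʳ
  ∷ arith add vʳ vʳ oneʳ
  ∷ arith add addrʳ vOffʳ (baseʳ next)
  ∷ load pʳ addrʳ
  ∷ jump 105
  ∷ halt
  ∷ []

module _ (W : ℕ) where

  infixr 5 _∷_
  infix 4 _⟶⟨_⟩_

  -- The index is an upper bound, since `done` accepts any b; branches of different length then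
  -- share one budget.
  data _⟶⟨_⟩_ (σ : State) : ℕ → State → Set where
    done : ∀ {b} → σ ⟶⟨ b ⟩ σ
    _∷_  : ∀ {σ′ τ b} → Step W program σ σ′ → σ′ ⟶⟨ b ⟩ τ → σ ⟶⟨ suc b ⟩ τ

module Execution {n : ℕ} (positions : Positions n) (W : ℕ) (room : 16 * (2 + n) ≤ W) where
  open Positions positions
  open Sweep positions

  infixr 4 _⇝_
  _⟶_⟨_⟩ : State → State → ℕ → Set
  σ ⟶ τ ⟨ b ⟩ = _⟶⟨_⟩_ W σ b τ

  _⇝_ : ∀ {σ τ υ a b} → σ ⟶ τ ⟨ a ⟩ → τ ⟶ υ ⟨ b ⟩ → σ ⟶ υ ⟨ a + b ⟩
  _⇝_ {a = a} done        t = slack a t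
    where
    slack : ∀ a {σ τ b} → σ ⟶ τ ⟨ b ⟩ → σ ⟶ τ ⟨ a + b ⟩
    slack a done = done
    slack a {σ} {τ} {suc b} (s ∷ t) = subst (λ c → σ ⟶ τ ⟨ c ⟩) (sym (+-suc a b)) (s ∷ slack a t)
  (s ∷ r) ⇝ t = s ∷ (r ⇝ t)

  within : ∀ {σ τ a b} → a ≤ b → σ ⟶ τ ⟨ a ⟩ → σ ⟶ τ ⟨ b ⟩
  within a≤b       done    = done
  within (s≤s a≤b) (s ∷ t) = s ∷ within a≤b t

  -- Memory layout and single instructions

  -- Interleaving the fields keeps them apart without a bound on the index.
  addr : Field → ℕ → Addr
  addr f j = j * 8 + (f + suc n)

  addr-injective : ∀ {f g i j} → f < 8 → g < 8 → addr f i ≡ addr g j → f ≡ g × i ≡ j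
  addr-injective {f} {g} {i} {j} f<8 g<8 eq = f≡g , *-cancelʳ-≡ i j 8 (+-cancelˡ-≡ f _ _
    (trans digits (cong (_+ j * 8) (sym f≡g))))
    where
    digits : f + i * 8 ≡ g + j * 8
    digits = +-cancelʳ-≡ (suc n) _ _ (trans (rotate (i * 8) f) (trans eq (sym (rotate (j * 8) g))))
      where
      rotate : ∀ a b → b + a + suc n ≡ a + (b + suc n)
      rotate a b = trans (cong (_+ suc n) (+-comm b a)) (+-assoc a b (suc n))

    f≡g : f ≡ g
    f≡g = begin
      f                ≡⟨ m<n⇒m%n≡m f<8 ⟨
      f % 8            ≡⟨ [m+kn]%n≡m%n f i 8 ⟨
      (f + i * 8) % 8  ≡⟨ cong (_% 8) digits ⟩
      (g + j * 8) % 8  ≡⟨ [m+kn]%n≡m%n g j 8 ⟩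
      g % 8            ≡⟨ m<n⇒m%n≡m g<8 ⟩
      g                ∎
      where open ≡-Reasoning

  n<addr : ∀ f j → n < addr f j
  n<addr f j = ≤-trans (m≤n+m (suc n) f) (m≤n+m (f + suc n) (j * 8))

  small : ∀ {a} → a ≤ suc n → a < W
  small a≤ = <-≤-trans (s≤s a≤) (≤-trans (m≤n*m (2 + n) 16) room)

  -- The largest address, for f = 7 and j = n + 1, is 9n + 16.
  scaled-address : ∀ {f j} → f ≤ 7 → j ≤ suc n → addr f j < W
  scaled-address {f} {j} f≤7 j≤ = <-≤-trans (s≤s (+-mono-≤ (*-monoˡ-≤ 8 j≤) (+-monoˡ-≤ (suc n) f≤7)))
    (≤-trans (m≤m+n _ (7 * n + 15)) (≤-trans (≤-reflexive (count n)) room))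
    where
    count : ∀ n → suc (suc n * 8 + (7 + suc n)) + (7 * n + 15) ≡ 16 * (2 + n)
    count = solve-∀

  scaled : ∀ {j} → j ≤ suc n → j * 8 < W
  scaled {j} j≤ = ≤-<-trans (m≤m+n (j * 8) (0 + suc n)) (scaled-address {0} z≤n j≤)

  constant : ∀ {k} → {T (k ≤ᵇ 31)} → k < W
  constant {k} {k≤} = <-≤-trans (s≤s (≤ᵇ⇒≤ k 31 k≤)) (≤-trans (*-monoʳ-≤ 16 (m≤m+n 2 n)) room)

  record Rep (A : Arrays) (m : Addr → ℕ) : Set where
    field
      fields : ∀ f j → {T (f <ᵇ 8)} → m (addr f j) ≡ A f j
      input  : ∀ {i} → 0 < i → i ≤ n → m i ≡ val i

  rep-put : ∀ {A m} f j x → {T (f <ᵇ 8)} → Rep A m → Rep (put A f j x) (m [ addr f j ↦ x ])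
  rep-put {A} {m} f j x {f<8} rep = record { fields = fields′ ; input = input′ }
    where
    open Rep rep

    fields′ : ∀ g i → {T (g <ᵇ 8)} → (m [ addr f j ↦ x ]) (addr g i) ≡ put A f j x g i
    fields′ g i {g<8} with g ≟ f
    ... | no g≢f = trans
      (↦-other m (g≢f ∘ proj₁ ∘ addr-injective {g} {f} {i} {j} (<ᵇ⇒< g 8 g<8) (<ᵇ⇒< f 8 f<8)))
      (fields g i {g<8})
    ... | yes refl with i ≟ j
    ...   | yes refl = ↦-same m (addr f j)
    ...   | no i≢j   = trans
      (↦-other m (i≢j ∘ proj₂ ∘ addr-injective {g} {g} {i} {j} (<ᵇ⇒< g 8 g<8) (<ᵇ⇒< f 8 f<8)))
      (fields g i {g<8})

    input′ : ∀ {i} → 0 < i → i ≤ n → (m [ addr f j ↦ x ]) i ≡ val i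
    input′ 0<i i≤n = trans (↦-other m (<⇒≢ (≤-<-trans i≤n (n<addr f j)))) (input 0<i i≤n)

  module _ {l : ℕ} {R : Reg → ℕ} {m : Addr → ℕ} where

    -- Operands enter through equations, so the new register holds the intended mathematical value
    -- instead of an expression in older register files.
    arith! : ∀ {o r s t a b} c → fetch program l ≡ just (arith o r s t) → R s ≡ a → R t ≡ b →
             ⟦ o ⟧ a b ≡ c → c < W → Step W program ⟨ l , R , m ⟩ ⟨ suc l , R [ r ↦ c ] , m ⟩
    arith! c i refl refl refl c<W = arith i c<W

    load! : ∀ {r s a} x → fetch program l ≡ just (load r s) → R s ≡ a → m a ≡ x →
            Step W program ⟨ l , R , m ⟩ ⟨ suc l , R [ r ↦ x ] , m ⟩
    load! x i refl refl = load i

    move! : ∀ {r s} x → fetch program l ≡ just (move r s) → R s ≡ x →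
            Step W program ⟨ l , R , m ⟩ ⟨ suc l , R [ r ↦ x ] , m ⟩
    move! x i refl = move i

    store! : ∀ {r s} a x → fetch program l ≡ just (store r s) → R r ≡ a → R s ≡ x →
             Step W program ⟨ l , R , m ⟩ ⟨ suc l , R , m [ a ↦ x ] ⟩
    store! a x i refl refl = store i

    scale! : ∀ {r s} j → fetch program l ≡ just (arith mul r s eightʳ) → R s ≡ j → R eightʳ ≡ 8 →
             j ≤ suc n → Step W program ⟨ l , R , m ⟩ ⟨ suc l , R [ r ↦ j * 8 ] , m ⟩
    scale! j i e₁ e₂ j≤ = arith! (j * 8) i e₁ e₂ refl (scaled j≤)

    addr! : ∀ {r s} f j → {T (f ≤ᵇ 7)} → fetch program l ≡ just (arith add r s (baseʳ f)) →
            R s ≡ j * 8 → R (baseʳ f) ≡ f + suc n → j ≤ suc n →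
            Step W program ⟨ l , R , m ⟩ ⟨ suc l , R [ r ↦ addr f j ] , m ⟩
    addr! f j {f≤7} i e₁ e₂ j≤ = arith! (addr f j) i e₁ e₂ refl (scaled-address (≤ᵇ⇒≤ f 7 f≤7) j≤)

    inc! : ∀ {r s} a → fetch program l ≡ just (arith add r s oneʳ) → R s ≡ a → R oneʳ ≡ 1 →
           a ≤ n → Step W program ⟨ l , R , m ⟩ ⟨ suc l , R [ r ↦ suc a ] , m ⟩
    inc! a i e₁ e₂ a≤ = arith! (suc a) i e₁ e₂ (+-comm a 1) (small (s≤s a≤))

    jlt-t! : ∀ {r s l′ a b} → fetch program l ≡ just (jlt r s l′) → R r ≡ a → R s ≡ b → a < b →
             Step W program ⟨ l , R , m ⟩ ⟨ l′ , R , m ⟩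
    jlt-t! i refl refl a<b = jlt-t i a<b

    jlt-f! : ∀ {r s l′ a b} → fetch program l ≡ just (jlt r s l′) → R r ≡ a → R s ≡ b → ¬ a < b →
             Step W program ⟨ l , R , m ⟩ ⟨ suc l , R , m ⟩
    jlt-f! i refl refl a≮b = jlt-f i a≮b

    jeq-t! : ∀ {r s l′ a b} → fetch program l ≡ just (jeq r s l′) → R r ≡ a → R s ≡ b → a ≡ b →
             Step W program ⟨ l , R , m ⟩ ⟨ l′ , R , m ⟩
    jeq-t! i refl refl a≡b = jeq-t i a≡b

    jeq-f! : ∀ {r s l′ a b} → fetch program l ≡ just (jeq r s l′) → R r ≡ a → R s ≡ b → a ≢ b →
             Step W program ⟨ l , R , m ⟩ ⟨ suc l , R , m ⟩
    jeq-f! i refl refl a≢b = jeq-f i a≢b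

  -- The parameters are register contents, so that Consts R computes and
  -- is definitionally insensitive to updates of the other registers.
  record Fixed (c₀ c₁ c₂ b₀ b₁ b₂ b₃ b₄ b₅ b₆ b₇ : ℕ) : Set where
    field
      zero≡    : c₀ ≡ 0
      one≡     : c₁ ≡ 1
      eight≡   : c₂ ≡ 8
      seen≡    : b₀ ≡ seen + suc n
      gap≡     : b₁ ≡ gap + suc n
      marks≡   : b₂ ≡ marks + suc n
      level≡   : b₃ ≡ level + suc n
      partner≡ : b₄ ≡ partner + suc n
      next≡    : b₅ ≡ next + suc n
      top≡     : b₆ ≡ top + suc n
      node≡    : b₇ ≡ node + suc n

  Consts : (Reg → ℕ) → Set
  Consts R = Fixed (R zeroʳ) (R oneʳ) (R eightʳ) (R (baseʳ seen)) (R (baseʳ gap)) (R (baseʳ marks))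
                   (R (baseʳ level)) (R (baseʳ partner)) (R (baseʳ next)) (R (baseʳ top)) (R (baseʳ node))

  Frame : ℕ → ℕ → (Reg → ℕ) → Set
  Frame x p R = Consts R × R xʳ ≡ suc x × R pʳ ≡ p × R pOffʳ ≡ p * 8

  -- Simulation of the walks

  inversion? : ∀ u v → Dec (u < v × 0 < pos v × pos v < pos u)
  inversion? u v = (u <? v) ×-dec (0 <? pos v) ×-dec (pos v <? pos u)

  I : ℕ → ℕ → ℕ
  I u v = 𝟙 (inversion? u v)

  record Scanned (σ : State) (b x p : ℕ) : Set where
    constructor scanned
    field
      {A′}     : Arrays
      {R′}     : Reg → ℕ
      {m′}     : Addr → ℕ
      s        : ℕ
      run      : σ ⟶ ⟨ 44 , R′ , m′ ⟩ ⟨ b ⟩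
      rep      : Rep A′ m′
      frame    : Frame x p R′
      off      : R′ vOffʳ ≡ s * 8
      progress : Progress x s A′
      0<s      : 0 < s
      s≤       : s ≤ suc n
      s-free   : pos s ≤ suc x
      prev≡    : prev A′ s ≡ p

  prepend-scan : ∀ {σ τ a b c x p} → σ ⟶ τ ⟨ a ⟩ → a + b ≤ c → Scanned τ b x p → Scanned σ c x p
  prepend-scan r le s = record { Scanned s ; run = within le (r ⇝ Scanned.run s) }

  -- Each further value v on the walk satisfies `p < v` and `pos v < pos p`, so it removes one
  -- inversion from `sumTo y (I p)`. The bound r is thus both the fuel of the recursion and the
  -- remaining budget. The longest round takes 8 + 4 + 3 + 1 + 10 = 26 instructions.
  scan : ∀ r {x p y A R m} → Rep A m → Frame x p R → R vʳ ≡ y → R accʳ ≡ rank (A top) y →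
         Progress x y A → pos p ≡ suc x → p < y → y ≤ suc n → pos y ≤ suc x →
         sumTo y (I p) ≤ r → Scanned ⟨ 17 , R , m ⟩ (26 * suc r) x p
  scan r {x} {p} {y} {A} {R} {m} rep frame@(k , xe , pe , poe) ve ae progress p≡ p<y y≤ y-free U≤r =
    body (v ≟ p) r U≤r
    where
    open Fixed k
    0<y = ≤-<-trans z≤n p<y
    open LinkAt (Base.link (Progress.base progress) 0<y y≤ y-free)

    v = prev A y
    f = rank (A top) v
    v≤ = ≤-trans (<⇒≤ prev<) y≤
    f≤ = m≤n⇒m≤1+n (rank≤n (A top) v)

    R₁ : Reg → ℕ
    R₁ = R [ vOffʳ ↦ y * 8 ] [ addrʳ ↦ addr marks y ] [ tmpʳ ↦ A marks y ] [ accʳ ↦ f ]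
           [ addrʳ ↦ addr gap y ] [ tmpʳ ↦ A gap y ] [ vʳ ↦ y ∸ A gap y ] [ vʳ ↦ v ]

    head : ⟨ 17 , R , m ⟩ ⟶ ⟨ 25 , R₁ , m ⟩ ⟨ 8 ⟩
    head = scale! y refl ve eight≡ y≤
         ∷ addr! marks y refl refl marks≡ y≤
         ∷ load! (A marks y) refl refl (Rep.fields rep marks y)
         ∷ arith! f refl ae refl count (small f≤)
         ∷ addr! gap y refl refl gap≡ y≤
         ∷ load! (A gap y) refl refl (Rep.fields rep gap y)
         ∷ arith! (y ∸ A gap y) refl ve refl refl (small (≤-trans (m∸n≤m y (A gap y)) y≤))
         ∷ arith! v refl refl one≡ refl (small v≤)
         ∷ done

    R₂ : Reg → ℕ
    R₂ = R₁ [ offʳ ↦ v * 8 ] [ addrʳ ↦ addr level v ] [ tmpʳ ↦ A level v ]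

    R₃ : Reg → ℕ
    R₃ = R₂ [ addrʳ ↦ addr partner v ] [ tmpʳ ↦ A partner v ]

    test : v ≢ p → ⟨ 25 , R₁ , m ⟩ ⟶ ⟨ 29 , R₂ , m ⟩ ⟨ 4 ⟩
    test v≢p = jeq-f! refl refl pe v≢p
             ∷ scale! v refl refl eight≡ v≤
             ∷ addr! level v refl refl level≡ v≤
             ∷ load! (A level v) refl refl (Rep.fields rep level v)
             ∷ done

    test₂ : ¬ A level v < f → ⟨ 29 , R₂ , m ⟩ ⟶ ⟨ 32 , R₃ , m ⟩ ⟨ 3 ⟩
    test₂ l≮f = jlt-f! refl refl refl l≮f
              ∷ addr! partner v refl refl partner≡ v≤
              ∷ load! (A partner v) refl refl (Rep.fields rep partner v)
              ∷ done

    offer : ∀ S → Frame x p S → S vʳ ≡ v → S accʳ ≡ f → S offʳ ≡ v * 8 →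
            ∃[ S′ ] ∃[ m′ ] (⟨ 34 , S , m ⟩ ⟶ ⟨ 17 , S′ , m′ ⟩ ⟨ 10 ⟩ × Rep (offered A v f p) m′ ×
              Frame x p S′ × S′ vʳ ≡ v × S′ accʳ ≡ f)
    offer S frame@(j , _ , pe , _) ve ae oe = _ , _ ,
      ( addr! level v refl oe J.level≡ v≤
      ∷ store! (addr level v) f refl refl ae
      ∷ addr! partner v refl oe J.partner≡ v≤
      ∷ store! (addr partner v) p refl refl pe
      ∷ scale! f refl ae J.eight≡ f≤
      ∷ addr! node f refl refl J.node≡ f≤
      ∷ load! (A node f) refl refl (Rep.fields rep₂ node f)
      ∷ addr! next v refl oe J.next≡ v≤
      ∷ store! (addr next v) (A node f) refl refl refl
      ∷ jump refl
      ∷ done) , rep-put next v (A node f) rep₂ , frame , ve , ae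
      where
      module J = Fixed j
      rep₂ = rep-put partner v p (rep-put level v f rep)

    body : Dec (v ≡ p) → ∀ r → sumTo y (I p) ≤ r → Scanned ⟨ 17 , R , m ⟩ (26 * suc r) x p
    body (yes v≡p) r U≤r = scanned y
      (within (≤-trans (m≤m+n 9 17) (*-monoʳ-≤ 26 (s≤s z≤n))) (head ⇝ jeq-t! refl refl pe v≡p ∷ done {b = 0}))
      rep frame refl progress 0<y y≤ y-free v≡p
    body (no v≢p) r U≤r = next-round r U≤r
      where
      p<v : p < v
      p<v = ≤∧≢⇒< (≮⇒≥ λ v<p → <⇒≱ (between v<p p<y) (≤-reflexive p≡)) (≢-sym v≢p)

      v-free : pos v ≤ x
      v-free = free-below p≡ v≢p prev-free

      inversion : I p v ≡ 1
      inversion = 𝟙-yes (inversion? p v)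
        (p<v , v-positive progress 0<y y≤ y-free p≡ p<v , ≤-trans (s≤s v-free) (≤-reflexive (sym p≡)))

      U-decreases : suc (sumTo v (I p)) ≤ sumTo y (I p)
      U-decreases = ≤-trans (≤-reflexive (cong (_+ sumTo v (I p)) (sym inversion))) (sumTo-monoˡ (I p) prev<)

      next-round : ∀ r → sumTo y (I p) ≤ r → Scanned ⟨ 17 , R , m ⟩ (26 * suc r) x p
      next-round zero    U≤ = contradiction (≤-trans U-decreases U≤) λ ()
      next-round (suc r) U≤ = decide (A level v <? f) (A partner v <? p)
        where
        budget : ∀ {a} → a ≤ 26 → a + 26 * suc r ≤ 26 * suc (suc r)
        budget a≤ = ≤-trans (+-monoˡ-≤ (26 * suc r) a≤) (≤-reflexive (sym (*-suc 26 (suc r))))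

        U≤′ = s≤s⁻¹ (≤-trans U-decreases U≤)

        accept : A level v < f ⊎ A partner v < p → ∀ S {a} → a + 10 ≤ 26 → Frame x p S → S vʳ ≡ v →
                 S accʳ ≡ f → S offʳ ≡ v * 8 →
                 ⟨ 17 , R , m ⟩ ⟶ ⟨ 34 , S , m ⟩ ⟨ a ⟩ → Scanned ⟨ 17 , R , m ⟩ (26 * suc (suc r)) x p
        accept better S a≤ frame ve ae oe run =
          let (S′ , m′ , run′ , rep′ , frame′ , ve′ , ae′) = offer S frame ve ae oe in
          prepend-scan (run ⇝ run′) (budget a≤)
            (scan r rep′ frame′ ve′ ae′ (progress-offer progress 0<y y≤ y-free p≡ p<v better)
              p≡ p<v v≤ prev-free U≤′)

        decide : Dec (A level v < f) → Dec (A partner v < p) → Scanned ⟨ 17 , R , m ⟩ (26 * suc (suc r)) x p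
        decide (yes l<f) _ = accept (inj₁ l<f) R₂ (m≤m+n 23 3) frame refl refl refl
          (head ⇝ test v≢p ⇝ jlt-t! refl refl refl l<f ∷ done {b = 0})
        decide (no l≮f) (yes q<p) = accept (inj₂ q<p) R₃ (m≤m+n 26 0) frame refl refl refl
          (head ⇝ test v≢p ⇝ test₂ l≮f ⇝ jlt-t! refl refl pe q<p ∷ done {b = 0})
        decide (no l≮f) (no q≮p) = prepend-scan {a = 17}
          (head ⇝ test v≢p ⇝ test₂ l≮f ⇝ jlt-f! refl refl pe q≮p ∷ jump refl ∷ done {b = 0})
          (budget (m≤m+n 17 9))
          (scan r rep frame refl refl (progress-skip progress 0<y y≤ y-free p≡ p<v l≮f q≮p)
            p≡ p<v v≤ prev-free U≤′)

  Stage : ℕ → ℕ → ℕ → ℕ → ℕ → ℕ → (Reg → ℕ) → Set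
  Stage x p s w q o R = Frame x p R × R vOffʳ ≡ s * 8 × R offʳ ≡ w * 8 × R qʳ ≡ q × R oʳ ≡ o

  record Found (σ : State) (l b x p s w q o z₀ : ℕ) (m : Addr → ℕ) : Set where
    constructor found
    field
      {R′}  : Reg → ℕ
      z     : ℕ
      run   : σ ⟶ ⟨ l , R′ , m ⟩ ⟨ b ⟩
      stage : Stage x p s w q o R′
      tmp≡  : R′ tmpʳ ≡ z * 8
      owner : Owner (suc x) z₀ z
      z≤p   : z ≤ p

  module _ {l x p s w q o : ℕ} {A : Arrays} {m : Addr → ℕ}
           (i₀ : fetch program l ≡ just (arith mul tmpʳ zʳ eightʳ))
           (i₁ : fetch program (1 + l) ≡ just (arith add addrʳ tmpʳ (baseʳ seen)))
           (i₂ : fetch program (2 + l) ≡ just (load addrʳ addrʳ))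
           (i₃ : fetch program (3 + l) ≡ just (jeq addrʳ zeroʳ (6 + l)))
           (i₄ : fetch program (4 + l) ≡ just (arith add zʳ zʳ oneʳ))
           (i₅ : fetch program (5 + l) ≡ just (jump l))
           (rep : Rep A m) (p≡ : pos p ≡ suc x) (p≤n : p ≤ n)
           (set : ∀ {v} → suc x < pos v → A seen v ≡ 1) (clear : ∀ {v} → pos v ≤ suc x → A seen v ≡ 0)
           where

    -- The program contains this loop twice, hence the abstract start l. A swept z below p is a
    -- neighbour of p, so each step up adds an inversion to the sum over u below z; as p is still
    -- unswept, the walk ends at p at the latest.
    find : ∀ r {z R} → Stage x p s w q o R → R zʳ ≡ z → z ≤ p →
           sumTo p (λ u → I u p) ≤ sumTo z (λ u → I u p) + r →
           Found ⟨ l , R , m ⟩ (6 + l) (6 * suc r) x p s w q o z m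
    find r {z} {R} stage@((k , _) , _) ze z≤p L≤ = go (pos z ≤? suc x) r L≤
      where
      open Fixed k

      R₁ : Reg → ℕ
      R₁ = R [ tmpʳ ↦ z * 8 ] [ addrʳ ↦ addr seen z ] [ addrʳ ↦ A seen z ]

      z≤ = m≤n⇒m≤1+n (≤-trans z≤p p≤n)

      head : ⟨ l , R , m ⟩ ⟶ ⟨ 3 + l , R₁ , m ⟩ ⟨ 3 ⟩
      head = scale! z i₀ ze eight≡ z≤
           ∷ addr! seen z i₁ refl seen≡ z≤
           ∷ load! (A seen z) i₂ refl (Rep.fields rep seen z)
           ∷ done

      go : Dec (pos z ≤ suc x) → ∀ r → sumTo p (λ u → I u p) ≤ sumTo z (λ u → I u p) + r →
           Found ⟨ l , R , m ⟩ (6 + l) (6 * suc r) x p s w q o z m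
      go (yes z-free) r L≤ = found z
        (within (≤-trans (m≤m+n 4 2) (*-monoʳ-≤ 6 (s≤s z≤n)))
          (head ⇝ jeq-t! i₃ refl zero≡ (clear z-free) ∷ done {b = 0}))
        stage refl
        (record { q≤z = ≤-refl ; z-free = z-free ; all-set = λ z≤u u<z → contradiction z≤u (<⇒≱ u<z) })
        z≤p
      go (no z-set) r L≤ = advance-by r L≤
        where
        z<p : z < p
        z<p = ≤∧≢⇒< z≤p λ { refl → z-set (≤-reflexive p≡) }

        L-suc : sumTo (suc z) (λ u → I u p) ≡ suc (sumTo z (λ u → I u p))
        L-suc = cong (_+ sumTo z (λ u → I u p)) (𝟙-yes (inversion? z p)
          (z<p , subst (0 <_) (sym p≡) z<s , subst (_< pos z) (sym p≡) (≰⇒> z-set)))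

        L-grows : suc (sumTo z (λ u → I u p)) ≤ sumTo p (λ u → I u p)
        L-grows = ≤-trans (≤-reflexive (sym L-suc)) (sumTo-monoˡ (λ u → I u p) z<p)

        widen : ∀ {z′} → Owner (suc x) (suc z) z′ → Owner (suc x) z z′
        widen owner = record
          { q≤z     = <⇒≤ (Owner.q≤z owner)
          ; z-free  = Owner.z-free owner
          ; all-set = λ {u} z≤u u<z′ →
              [ (λ z<u → Owner.all-set owner z<u u<z′) , (λ { refl → ≰⇒> z-set }) ]′ (m≤n⇒m<n∨m≡n z≤u)
          }

        advance-by : ∀ r → sumTo p (λ u → I u p) ≤ sumTo z (λ u → I u p) + r →
                     Found ⟨ l , R , m ⟩ (6 + l) (6 * suc r) x p s w q o z m
        advance-by zero    L≤ = contradiction (≤-trans L-grows L≤) (<⇒≱ (s≤s (≤-reflexive (+-identityʳ _))))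
        advance-by (suc r) L≤ =
          let rest = find r {suc z} {R₁ [ zʳ ↦ suc z ]} stage refl z<p
                       (≤-trans L≤ (≤-reflexive (trans (+-suc (sumTo z (λ u → I u p)) r)
                         (cong (_+ r) (sym L-suc)))))
          in record
            { Found rest
            ; run   = within {a = 6 + 6 * suc r} (≤-reflexive (sym (*-suc 6 (suc r))))
                (( head
                 ⇝ jeq-f! i₃ refl zero≡ (λ e → contradiction (trans (sym (set (≰⇒> z-set))) e) λ ())
                 ∷ inc! z i₄ ze one≡ (≤-trans z≤p p≤n)
                 ∷ jump i₅
                 ∷ done {b = 0}) ⇝ Found.run rest)
            ; owner = widen (Found.owner rest)
            }

  record Updated (σ : State) (b x p s : ℕ) : Set where
    constructor updated
    field
      {A′}       : Arrays
      {R′}       : Reg → ℕ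
      {m′}       : Addr → ℕ
      run        : σ ⟶ ⟨ 80 , R′ , m′ ⟩ ⟨ b ⟩
      rep        : Rep A′ m′
      frame      : Frame x p R′
      off        : R′ vOffʳ ≡ s * 8
      base       : Base (suc x) x A′
      candidates : ∀ {v} → 0 < pos v → pos v ≤ x → Candidate x A′ v
      prev≡      : prev A′ s ≡ p

  lowerCount : ℕ → ℕ
  lowerCount p = sumTo p (λ u → I u p)

  -- The straight-line code accounts for 8 + 2 + 5 + 8 = 23, and each of the two upward walks for at
  -- most `6 * suc (lowerCount p)`.
  update : ∀ {x p s A R m} → Rep A m → Frame x p R → R vOffʳ ≡ s * 8 → pos p ≡ suc x → p ≤ n →
           Base (suc x) (suc x) A → Candidate (suc x) A p →
           (∀ {v} → 0 < pos v → pos v ≤ x → Candidate x A v) → prev A s ≡ p →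
           Updated ⟨ 44 , R , m ⟩ (23 + 12 * suc (lowerCount p)) x p s
  update {x} {p} {s} {A} {R} {m} rep frame@(k , xe , pe , poe) ve p≡ p≤n base cand candidates prev≡ =
    decide (o <? q)
    where
    open Fixed k
    w = suc (A level p)
    q = A partner p
    o = A top w
    level≤ = candidate-level≤n cand
    w≤ = s≤s level≤
    p≤ = m≤n⇒m≤1+n p≤n
    c = lowerCount p

    R₁ : Reg → ℕ
    R₁ = R [ addrʳ ↦ addr level p ] [ wʳ ↦ A level p ] [ wʳ ↦ w ] [ addrʳ ↦ addr partner p ]
           [ qʳ ↦ q ] [ offʳ ↦ w * 8 ] [ addrʳ ↦ addr top w ] [ oʳ ↦ o ]

    head : ⟨ 44 , R , m ⟩ ⟶ ⟨ 52 , R₁ , m ⟩ ⟨ 8 ⟩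
    head = addr! level p refl poe level≡ p≤
         ∷ load! (A level p) refl refl (Rep.fields rep level p)
         ∷ inc! (A level p) refl refl one≡ level≤
         ∷ addr! partner p refl poe partner≡ p≤
         ∷ load! q refl refl (Rep.fields rep partner p)
         ∷ scale! w refl refl eight≡ w≤
         ∷ addr! top w refl refl top≡ w≤
         ∷ load! o refl refl (Rep.fields rep top w)
         ∷ done

    marks≤ : ∀ z → z ≤ p → pos z ≤ suc x → A marks z ≤ n
    marks≤ zero    _   _      = ≤-trans (≤-reflexive (Base.marks-0 base)) z≤n
    marks≤ (suc z) z≤p z-free = LinkAt.m≤n (Base.link base z<s (≤-trans z≤p p≤) z-free)

    q<p : o < q → q < p
    q<p o<q = [ (λ (q≡0 , _) → contradiction (subst (o <_) q≡0 o<q) λ ()) , (λ (_ , q<p , _) → q<p) ]′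
              (CandidateAt.sound cand)

    raise : (o<q : o < q) → Updated ⟨ 44 , R , m ⟩ (23 + 12 * suc c) x p s
    raise o<q = first
      (find {A = A} refl refl refl refl refl refl rep p≡ p≤n (Base.flag-yes base) (Base.flag-no base)
        c {q} {R₁ [ zʳ ↦ q ]} (frame , ve , refl , refl , refl) refl (<⇒≤ (q<p o<q)) (m≤n+m c _))
      where
      first : Found ⟨ 55 , R₁ [ zʳ ↦ q ] , m ⟩ 61 (6 * suc c) x p s w q o q m →
              Updated ⟨ 44 , R , m ⟩ (23 + 12 * suc c) x p s
      first (found {R₂} z₁ run₁ (frame₂@(k₂ , _) , ve₂ , oe₂ , qe₂ , toe₂) te₁ owner₁ z₁≤p) = second
        (find {A = put A marks z₁ (suc (A marks z₁))} refl refl refl refl refl refl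
          (rep-put marks z₁ (suc (A marks z₁)) rep) p≡ p≤n (Base.flag-yes base) (Base.flag-no base)
          c {o} {R₃} (frame₂ , ve₂ , oe₂ , qe₂ , toe₂) refl (<⇒≤ (<-trans o<q (q<p o<q))) (m≤n+m c _))
        where
        module K₂ = Fixed k₂
        z₁≤ = ≤-trans z₁≤p p≤
        m₁ = m [ addr marks z₁ ↦ suc (A marks z₁) ]

        R₃ : Reg → ℕ
        R₃ = R₂ [ addrʳ ↦ addr marks z₁ ] [ tmpʳ ↦ A marks z₁ ] [ tmpʳ ↦ suc (A marks z₁) ] [ zʳ ↦ o ]

        count-new : ⟨ 61 , R₂ , m ⟩ ⟶ ⟨ 66 , R₃ , m₁ ⟩ ⟨ 5 ⟩
        count-new = addr! marks z₁ refl te₁ K₂.marks≡ z₁≤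
                  ∷ load! (A marks z₁) refl refl (Rep.fields rep marks z₁)
                  ∷ inc! (A marks z₁) refl refl K₂.one≡ (marks≤ z₁ z₁≤p (Owner.z-free owner₁))
                  ∷ store! (addr marks z₁) (suc (A marks z₁)) refl refl refl
                  ∷ move! o refl toe₂
                  ∷ done

        second : Found ⟨ 66 , R₃ , m₁ ⟩ 72 (6 * suc c) x p s w q o o m₁ →
                 Updated ⟨ 44 , R , m ⟩ (23 + 12 * suc c) x p s
        second (found {R₄} z₂ run₂ (frame₄@(k₄ , _ , pe₄ , _) , ve₄ , oe₄ , qe₄ , _) te₂ owner₂ z₂≤p) = updated
          (within (≤-reflexive (total c))
            (head ⇝ (jlt-t! refl refl refl o<q ∷ move! q refl refl ∷ done {b = 0}) ⇝ run₁ ⇝ count-new ⇝ run₂ ⇝ tail))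
          (rep-put node w p (rep-put top w q rep₂))
          frame₄ ve₄ (base-raise base cand p≡ o<q owner₁ owner₂)
          (λ 0<v v-free → candidate-stable {A = A} (λ _ → refl , refl) (candidates 0<v v-free))
          prev≡
          where
          module K₄ = Fixed k₄
          z₂≤ = ≤-trans z₂≤p p≤
          y = incremented (A marks) z₁ z₂
          rep₁ = rep-put marks z₁ (suc (A marks z₁)) rep
          rep₂ = rep-put marks z₂ (y ∸ 1) rep₁

          y≤ : y ∸ 1 ≤ n
          y≤ = ≤-trans (∸-monoˡ-≤ 1 (≤-trans (≤-reflexive (incremented-𝟙 (A marks) z₁ z₂))
                 (+-monoʳ-≤ (A marks z₂) (𝟙≤1 (z₂ ≟ z₁)))))
               (≤-trans (≤-reflexive (m+n∸n≡m (A marks z₂) 1)) (marks≤ z₂ z₂≤p (Owner.z-free owner₂)))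

          tail : ⟨ 72 , R₄ , m₁ ⟩ ⟶ ⟨ 80 , _ , _ ⟩ ⟨ 8 ⟩
          tail = addr! marks z₂ refl te₂ K₄.marks≡ z₂≤
               ∷ load! y refl refl (Rep.fields rep₁ marks z₂)
               ∷ arith! (y ∸ 1) refl refl K₄.one≡ refl (small (m≤n⇒m≤1+n y≤))
               ∷ store! (addr marks z₂) (y ∸ 1) refl refl refl
               ∷ addr! top w refl oe₄ K₄.top≡ w≤
               ∷ store! (addr top w) q refl refl qe₄
               ∷ addr! node w refl oe₄ K₄.node≡ w≤
               ∷ store! (addr node w) p refl refl pe₄
               ∷ done

          total : ∀ c → 8 + (2 + (6 * suc c + (5 + (6 * suc c + 8)))) ≡ 23 + 12 * suc c
          total = solve-∀

    decide : Dec (o < q) → Updated ⟨ 44 , R , m ⟩ (23 + 12 * suc c) x p s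
    decide (no o≮q)  = updated
      (within {a = 10} (≤-trans (m≤m+n 10 13) (m≤m+n 23 _))
        (head ⇝ jlt-f! refl refl refl o≮q ∷ jump refl ∷ done {b = 0}))
      rep frame ve (base-keep base cand p≡ o≮q) candidates prev≡
    decide (yes o<q) = raise o<q

  -- Rounds and their accumulated cost

  record Swept (σ : State) (l b x : ℕ) : Set where
    constructor swept
    field
      {A′}   : Arrays
      {R′}   : Reg → ℕ
      {m′}   : Addr → ℕ
      run    : σ ⟶ ⟨ l , R′ , m′ ⟩ ⟨ b ⟩
      rep    : Rep A′ m′
      consts : Consts R′
      x≡     : R′ xʳ ≡ x
      inv    : Inv x A′

  prepend-sweep : ∀ {σ τ a b c l x} → σ ⟶ τ ⟨ a ⟩ → a + b ≤ c → Swept τ l b x → Swept σ l c x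
  prepend-sweep r le s = record { Swept s ; run = within le (r ⇝ Swept.run s) }

  merge : ∀ {x p s A R m} → Rep A m → Frame x p R → R vOffʳ ≡ s * 8 → pos p ≡ suc x → p ≤ n → suc x ≤ n →
          Base (suc x) x A → (∀ {v} → 0 < pos v → pos v ≤ x → Candidate x A v) →
          0 < s → s ≤ suc n → pos s ≤ suc x → prev A s ≡ p →
          Swept ⟨ 80 , R , m ⟩ 12 17 x
  merge {x} {p} {s} {A} {R} {m} rep (k , xe , pe , poe) ve p≡ p≤n x≤n base candidates 0<s s≤ s-free prev≡ = swept
    ( addr! gap p refl poe gap≡ p≤
    ∷ load! (A gap p) refl refl (Rep.fields rep gap p)
    ∷ arith! (A gap p + 1) refl refl one≡ refl (small (≤-trans (m≤n+m (A gap p + 1) (A gap s)) g≤))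
    ∷ addr! gap s refl ve gap≡ s≤
    ∷ load! (A gap s) refl refl (Rep.fields rep gap s)
    ∷ arith! g refl refl refl refl (small g≤)
    ∷ store! (addr gap s) g refl refl refl
    ∷ addr! marks p refl poe marks≡ p≤
    ∷ load! (A marks p) refl refl (Rep.fields rep₁ marks p)
    ∷ addr! marks s refl ve marks≡ s≤
    ∷ load! (A marks s) refl refl (Rep.fields rep₁ marks s)
    ∷ arith! c refl refl refl refl (small c≤)
    ∷ store! (addr marks s) c refl refl refl
    ∷ addr! seen p refl poe seen≡ p≤
    ∷ store! (addr seen p) 1 refl refl one≡
    ∷ arith! x refl xe one≡ refl (small (≤-trans (n≤1+n x) (m≤n⇒m≤1+n x≤n)))
    ∷ jump refl
    ∷ done)
    (rep-put seen p 1 (rep-put marks s c rep₁)) k refl inv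
    where
    open Fixed k
    p≤ = m≤n⇒m≤1+n p≤n
    g = A gap s + (A gap p + 1)
    c = A marks s + A marks p
    rep₁ = rep-put gap s g rep
    inv = inv-merge base candidates 0<s s≤ s-free p≡ prev≡

    -- The sums g and c are the gap and the mark of s after the merge, so the new invariant itself
    -- shows that they fit into a word.
    link-s : Link x (merged A s p) s
    link-s = Base.link (Inv.base inv) 0<s s≤ (free-below p≡
      (λ s≡p → <⇒≢ (LinkAt.prev< (Base.link base 0<s s≤ s-free)) (trans prev≡ (sym s≡p))) s-free)

    g≤ : g ≤ suc n
    g≤ = ≤-trans (≤-reflexive (sym (↦-same (A gap) s))) (≤-trans (<⇒≤ (LinkAt.gap< link-s)) s≤)

    c≤ : c ≤ suc n
    c≤ = ≤-trans (≤-reflexive (sym (↦-same (A marks) s))) (m≤n⇒m≤1+n (LinkAt.m≤n link-s))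

  degree : ℕ → ℕ
  degree p = sumTo (suc n) (I p) + sumTo (suc n) (λ u → I u p)

  -- The constant is 5 on entry, 26 for the final step of the walk down, 23 + 12 for the update and
  -- 17 for the merge.
  roundCost : ℕ → ℕ
  roundCost p = 83 + 26 * degree p

  round : ∀ {x A R m} → suc x ≤ n → Rep A m → Consts R → R xʳ ≡ suc x → Inv (suc x) A →
          Swept ⟨ 12 , R , m ⟩ 12 (roundCost (val (suc x))) x
  round {x} {A} {R} {m} x<n rep k xe inv = after-scan
    (scan (sumTo (suc n) (I p)) {y = suc n} {R = R₁} rep (k , xe , refl , refl) refl
      (sym (Tops.rank-head (Base.tops base)))
      (progress-start inv) p≡ (s≤s p≤n) ≤-refl (≤-trans (≤-reflexive pos-head) z≤n) ≤-refl)
    where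
    open Fixed k
    open Inv inv
    p = val (suc x)
    p≡ = pos-val z<s x<n
    p≤n = proj₂ (in-range (subst (0 <_) (sym p≡) z<s))
    u = sumTo (suc n) (I p)
    c = lowerCount p

    R₁ : Reg → ℕ
    R₁ = R [ pʳ ↦ p ] [ pOffʳ ↦ p * 8 ] [ vʳ ↦ suc n ] [ accʳ ↦ 0 ]

    head : ⟨ 12 , R , m ⟩ ⟶ ⟨ 17 , R₁ , m ⟩ ⟨ 5 ⟩
    head = jeq-f! refl xe zero≡ (λ ())
         ∷ load! p refl xe (Rep.input rep z<s x<n)
         ∷ scale! p refl refl eight≡ (m≤n⇒m≤1+n p≤n)
         ∷ move! (suc n) refl seen≡
         ∷ move! 0 refl zero≡
         ∷ done

    cost : ∀ u c c′ → c ≤ c′ → 5 + (26 * suc u + (23 + 12 * suc c)) + 17 ≤ 83 + 26 * (u + c′)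
    cost u c c′ c≤c′ = ≤-trans
      (+-monoˡ-≤ 17 (+-monoʳ-≤ 5 (+-monoʳ-≤ (26 * suc u) (+-monoʳ-≤ 23 (*-monoʳ-≤ 12 (s≤s c≤c′))))))
      (≤-trans (m≤m+n _ (14 * c′)) (≤-reflexive (total u c′)))
      where
      total : ∀ u c → 5 + (26 * suc u + (23 + 12 * suc c)) + 17 + 14 * c ≡ 83 + 26 * (u + c)
      total = solve-∀

    after-scan : Scanned ⟨ 17 , R₁ , m ⟩ (26 * suc u) x p → Swept ⟨ 12 , R , m ⟩ 12 (roundCost p) x
    after-scan (scanned s run₁ rep₁ frame₁ off₁ progress 0<s s≤ s-free prev≡) = after-update
      (update rep₁ frame₁ off₁ p≡ p≤n (Progress.base progress)
        (Progress.todo progress (subst (0 <_) (sym p≡) z<s) (≤-reflexive p≡) p<s)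
        (progress-end progress 0<s s≤ s-free p≡ prev≡) prev≡)
      where
      p<s = subst (_< s) prev≡ (LinkAt.prev< (Base.link (Progress.base progress) 0<s s≤ s-free))

      after-update : Updated ⟨ 44 , _ , _ ⟩ (23 + 12 * suc c) x p s → Swept ⟨ 12 , R , m ⟩ 12 (roundCost p) x
      after-update (updated run₂ rep₂ frame₂ off₂ base₂ candidates₂ prev≡₂) =
        prepend-sweep (head ⇝ run₁ ⇝ run₂) (cost u c _ (sumTo-monoˡ (λ v → I v p) (m≤n⇒m≤1+n p≤n)))
          (merge rep₂ frame₂ off₂ p≡ p≤n x<n base₂ candidates₂ 0<s s≤ s-free prev≡₂)

  -- The sum runs over values with an indicator on their positions, so that at x = n it is bounded
  -- by the plain degree sum without reindexing along the permutation.
  budget : ℕ → ℕ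
  budget x = 83 * x + 26 * sumTo (suc n) (λ p → 𝟙 (pos p ≤? x) * degree p)

  budget-step : ∀ {x} → suc x ≤ n → roundCost (val (suc x)) + suc (budget x) ≤ suc (budget (suc x))
  budget-step {x} x<n = regroup (degree p) _ _ x
    (sumTo-gain (suc n) p (degree p) (s≤s (proj₂ (in-range (subst (0 <_) (sym p≡) z<s))))
      (λ v → *-monoˡ-≤ (degree v) (𝟙-mono (pos v ≤? x) (pos v ≤? suc x) m≤n⇒m≤1+n))
      (≤-reflexive (begin
        degree p + 𝟙 (pos p ≤? x) * degree p  ≡⟨ cong (λ i → degree p + i * degree p)
                                                   (𝟙-no (pos p ≤? x) (λ p≤x → 1+n≰n (subst (_≤ x) p≡ p≤x))) ⟩
        degree p + 0                          ≡⟨⟩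
        1 * degree p                          ≡⟨ cong (_* degree p) (𝟙-yes (pos p ≤? suc x) (≤-reflexive p≡)) ⟨
        𝟙 (pos p ≤? suc x) * degree p         ∎)))
    where
    open ≡-Reasoning
    p = val (suc x)
    p≡ = pos-val z<s x<n

    regroup : ∀ d a b x → d + a ≤ b → (83 + 26 * d) + suc (83 * x + 26 * a) ≤ suc (83 * suc x + 26 * b)
    regroup d a b x d+a≤b = ≤-trans (≤-reflexive (total d a x))
      (s≤s (+-monoʳ-≤ (83 * suc x) (*-monoʳ-≤ 26 d+a≤b)))
      where
      total : ∀ d a x → (83 + 26 * d) + suc (83 * x + 26 * a) ≡ suc (83 * suc x + 26 * (d + a))
      total = solve-∀

  sweep : ∀ x {A R m} → x ≤ n → Rep A m → Consts R → R xʳ ≡ x → Inv x A →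
          Swept ⟨ 12 , R , m ⟩ 97 (suc (budget x)) 0
  sweep zero    _   rep k xe inv = swept (jeq-t! refl xe (Fixed.zero≡ k) refl ∷ done) rep k xe inv
  sweep (suc x) {A} {R} {m} x<n rep k xe inv = after (round x<n rep k xe inv)
    where
    after : Swept ⟨ 12 , R , m ⟩ 12 (roundCost (val (suc x))) x → Swept ⟨ 12 , R , m ⟩ 97 (suc (budget (suc x))) 0
    after (swept run rep′ k′ xe′ inv′) =
      prepend-sweep run (budget-step x<n) (sweep x (<⇒≤ x<n) rep′ k′ xe′ inv′)

  start : ∀ {m} → m 0 ≡ n → Rep (λ _ _ → 0) m → Swept ⟨ 0 , (λ _ → 0) , m ⟩ 12 12 n
  start {m} m0≡n rep = swept
    ( load! n refl refl m0≡n
    ∷ const refl constant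
    ∷ const refl constant
    ∷ inc! n refl refl refl ≤-refl
    ∷ base! 1 (m≤m+n 1 6) refl refl refl
    ∷ base! 2 (m≤m+n 2 5) refl refl refl
    ∷ base! 3 (m≤m+n 3 4) refl refl refl
    ∷ base! 4 (m≤m+n 4 3) refl refl refl
    ∷ base! 5 (m≤m+n 5 2) refl refl refl
    ∷ base! 6 (m≤m+n 6 1) refl refl refl
    ∷ base! 7 (m≤m+n 7 0) refl refl refl
    ∷ move! n refl refl
    ∷ done)
    rep
    (record { zero≡ = refl ; one≡ = refl ; eight≡ = refl ; seen≡ = refl ; gap≡ = refl ; marks≡ = refl
            ; level≡ = refl ; partner≡ = refl ; next≡ = refl ; top≡ = refl ; node≡ = refl })
    refl inv-initial
    where
    base! : ∀ {l R r s} f → f ≤ 7 → fetch program l ≡ just (arith add r s oneʳ) →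
            R s ≡ pred f + suc n → R oneʳ ≡ 1 → .{{NonZero f}} →
            Step W program ⟨ l , R , m ⟩ ⟨ suc l , R [ r ↦ f + suc n ] , m ⟩
    base! (suc f) f≤ i e₁ e₂ = arith! (suc f + suc n) i e₁ e₂ (+-comm (f + suc n) 1)
      (scaled-address {suc f} {0} f≤ z≤n)

  -- Writing the output

  pairs : ∀ {A lo x r k} → Linked A lo x r k → List (ℕ × ℕ)
  pairs []                         = []
  pairs {A} (cons {p = p} _ _ _ l) = (A partner p , p) ∷ pairs l

  flatten : List (ℕ × ℕ) → List ℕ
  flatten = concatMap (λ (q , p) → q ∷ p ∷ [])

  Fields : Arrays → (Addr → ℕ) → Set
  Fields A m = ∀ f j → {T (f <ᵇ 8)} → m (addr f j) ≡ A f j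

  fields-input : ∀ {A m a x} → a ≤ n → Fields A m → Fields A (m [ a ↦ x ])
  fields-input {m = m} a≤n fields f j {f<8} =
    trans (↦-other m (≢-sym (<⇒≢ (≤-<-trans a≤n (n<addr f j))))) (fields f j {f<8})

  record Emitted (σ : State) (b o : ℕ) (m : Addr → ℕ) (xs : List ℕ) : Set where
    constructor emitted
    field
      {R′}   : Reg → ℕ
      {m′}   : Addr → ℕ
      run    : σ ⟶ ⟨ 116 , R′ , m′ ⟩ ⟨ b ⟩
      stored : StoredAt m′ o xs
      before : ∀ {a} → a < o → m′ a ≡ m a

  emit : ∀ {A lo x r k o R m} (l : Linked A lo x r k) → Consts R → Fields A m →
         R pʳ ≡ r → R vʳ ≡ o → o ≤ suc lo → Emitted ⟨ 105 , R , m ⟩ (1 + k * 11) o m (flatten (pairs l))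
  emit [] c fields re oe o≤ = emitted (jeq-t! refl re (Fixed.zero≡ c) refl ∷ done) _ (λ _ → refl)
  emit {A} {lo} {k = suc k} {o} {R} {m} (cons {p = p} lo<q x<p (q<p , _) l) c fields re oe o≤ = after
    (emit {R = R₁} {m = m₂} l c (fields-input (≤-trans o<p p≤n) (fields-input (≤-trans (<⇒≤ o<p) p≤n) fields))
      refl refl (s≤s o<p))
    where
    open Fixed c
    q = A partner p
    p≤n = proj₂ (in-range (≤-<-trans z≤n x<p))
    p≤ = m≤n⇒m≤1+n p≤n

    o<p : o < p
    o<p = ≤-<-trans (≤-trans o≤ lo<q) q<p

    m₁ m₂ : Addr → ℕ
    m₁ = m [ o ↦ q ]
    m₂ = m₁ [ suc o ↦ p ]

    R₁ : Reg → ℕ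
    R₁ = R [ vOffʳ ↦ p * 8 ] [ addrʳ ↦ addr partner p ] [ tmpʳ ↦ q ] [ vʳ ↦ suc o ] [ vʳ ↦ suc (suc o) ]
           [ addrʳ ↦ addr next p ] [ pʳ ↦ A next p ]

    body : ⟨ 105 , R , m ⟩ ⟶ ⟨ 105 , R₁ , m₂ ⟩ ⟨ 11 ⟩
    body = jeq-f! refl re zero≡ (λ p≡0 → <⇒≢ (≤-<-trans z≤n o<p) (sym p≡0))
         ∷ scale! p refl re eight≡ p≤
         ∷ addr! partner p refl refl partner≡ p≤
         ∷ load! q refl refl (fields partner p)
         ∷ store! o q refl oe refl
         ∷ inc! o refl oe one≡ (≤-trans (<⇒≤ o<p) p≤n)
         ∷ store! (suc o) p refl refl re
         ∷ inc! (suc o) refl refl one≡ (≤-trans o<p p≤n)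
         ∷ addr! next p refl refl next≡ p≤
         ∷ load! (A next p) refl refl
             (fields-input (≤-trans o<p p≤n) (fields-input (≤-trans (<⇒≤ o<p) p≤n) fields) next p)
         ∷ jump refl
         ∷ done

    after : Emitted ⟨ 105 , R₁ , m₂ ⟩ (1 + k * 11) (suc (suc o)) m₂ (flatten (pairs l)) →
            Emitted ⟨ 105 , R , m ⟩ (1 + suc k * 11) o m (q ∷ p ∷ flatten (pairs l))
    after (emitted run stored before) = emitted
      (within (≤-reflexive (+-suc 11 (k * 11))) (body ⇝ run))
      ( trans (before (m<n⇒m<1+n (n<1+n o))) (trans (↦-other m₁ (<⇒≢ (n<1+n o))) (↦-same m o))
      , trans (before (n<1+n (suc o))) (↦-same m₁ (suc o))
      , stored)
      (λ a<o → trans (before (m<n⇒m<1+n (m<n⇒m<1+n a<o)))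
        (trans (↦-other m₁ (<⇒≢ (m<n⇒m<1+n a<o))) (↦-other m (<⇒≢ a<o))))

  module _ {m : Addr → ℕ} (m0≡n : m 0 ≡ n) (rep₀ : Rep (λ _ _ → 0) m) where

    private
      first : Swept ⟨ 0 , (λ _ → 0) , m ⟩ 97 (12 + suc (budget n)) 0
      first = let s = start m0≡n rep₀ in
        prepend-sweep (Swept.run s) ≤-refl (sweep n ≤-refl (Swept.rep s) (Swept.consts s) (Swept.x≡ s) (Swept.inv s))

      open Swept first
      open Fixed consts

    answer-size : ℕ
    answer-size = A′ marks (suc n)

    answer : Linked A′ 0 0 (A′ node answer-size) answer-size
    answer = final-linked inv

    answer-maximum : ∀ {k} → Chain 0 0 k → k ≤ answer-size
    answer-maximum = final-maximum inv

    answer-size≤n : answer-size ≤ n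
    answer-size≤n = LinkAt.m≤n (Base.link (Inv.base inv) z<s ≤-refl (≤-reflexive pos-head))

    execution : Emitted ⟨ 0 , (λ _ → 0) , m ⟩ (22 + budget n + n * 11) 0 m (answer-size ∷ flatten (pairs answer))
    execution = after
      (emit {R = R₁} {m = m₁} answer consts (fields-input z≤n (Rep.fields rep)) refl refl (s≤s z≤n))
      where
      K = answer-size

      R₁ : Reg → ℕ
      R₁ = R′ [ vOffʳ ↦ suc n * 8 ] [ addrʳ ↦ addr marks (suc n) ] [ tmpʳ ↦ K ] [ vOffʳ ↦ K * 8 ]
             [ addrʳ ↦ addr node K ] [ pʳ ↦ A′ node K ] [ vʳ ↦ 1 ]

      m₁ : Addr → ℕ
      m₁ = m′ [ 0 ↦ K ]

      head : ⟨ 97 , R′ , m′ ⟩ ⟶ ⟨ 105 , R₁ , m₁ ⟩ ⟨ 8 ⟩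
      head = scale! (suc n) refl seen≡ eight≡ ≤-refl
           ∷ addr! marks (suc n) refl refl marks≡ ≤-refl
           ∷ load! K refl refl (Rep.fields rep marks (suc n))
           ∷ store! 0 K refl zero≡ refl
           ∷ scale! K refl refl eight≡ (m≤n⇒m≤1+n answer-size≤n)
           ∷ addr! node K refl refl node≡ (m≤n⇒m≤1+n answer-size≤n)
           ∷ load! (A′ node K) refl refl (fields-input {A = A′} {m = m′} {x = K} z≤n (Rep.fields rep) node K)
           ∷ move! 1 refl one≡
           ∷ done

      total : ∀ b k n → k ≤ n → 12 + suc b + (8 + (1 + k * 11)) ≤ 22 + b + n * 11
      total b k n k≤n = ≤-trans (≤-reflexive (regroup b k)) (+-monoʳ-≤ (22 + b) (*-monoˡ-≤ 11 k≤n))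
        where
        regroup : ∀ b k → 12 + suc b + (8 + (1 + k * 11)) ≡ 22 + b + k * 11
        regroup = solve-∀

      after : Emitted ⟨ 105 , R₁ , m₁ ⟩ (1 + K * 11) 1 m₁ (flatten (pairs answer)) →
              Emitted ⟨ 0 , (λ _ → 0) , m ⟩ (22 + budget n + n * 11) 0 m (K ∷ flatten (pairs answer))
      after (emitted run′ stored before) = emitted
        (within (total (budget n) K n answer-size≤n) (run ⇝ head ⇝ run′))
        (before z<s , stored)
        (λ ())


-- Induced matchings as chains

label≤n : ∀ {n} (u : Fin n) → label u ≤ n
label≤n = toℕ<n

vertex : ∀ {n v} → 0 < v → v ≤ n → ∃[ u ] label {n} u ≡ v
vertex {v = suc _} _ v<n = fromℕ< v<n , cong suc (toℕ-fromℕ< v<n)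

module _ {n : ℕ} where

  onLabels : (Fin n → Fin n) → ℕ → ℕ
  onLabels f zero    = 0
  onLabels f (suc k) with k <? n
  ... | yes k<n = label (f (fromℕ< k<n))
  ... | no _    = 0

  onLabels-label : ∀ f u → onLabels f (label u) ≡ label (f u)
  onLabels-label f u with toℕ u <? n
  ... | yes u<n = cong (label ∘ f) (fromℕ<-toℕ u u<n)
  ... | no u≮n  = contradiction (toℕ<n u) u≮n

  onLabels≤n : ∀ f v → onLabels f v ≤ n
  onLabels≤n f zero    = z≤n
  onLabels≤n f (suc k) with k <? n
  ... | yes k<n = label≤n (f (fromℕ< k<n))
  ... | no _    = z≤n

  onLabels-range : ∀ f {v} → 0 < onLabels f v → 0 < v × v ≤ n
  onLabels-range f {suc k} 0<f with k <? n
  ... | yes k<n = z<s , k<n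

  onLabels-inverse : ∀ f g → (∀ u → g (f u) ≡ u) → ∀ {v} → 0 < v → v ≤ n → onLabels g (onLabels f v) ≡ v
  onLabels-inverse f g gf 0<v v≤n with vertex 0<v v≤n
  ... | u , refl = trans (cong (onLabels g) (onLabels-label f u)) (trans (onLabels-label g (f u)) (cong label (gf u)))

  onLabels-positive : ∀ f {v} → 0 < v → v ≤ n → 0 < onLabels f v
  onLabels-positive f 0<v v≤n with vertex 0<v v≤n
  ... | u , refl = subst (0 <_) (sym (onLabels-label f u)) z<s

  permutationPositions : Permutation′ n → Positions n
  permutationPositions π = record
    { pos          = onLabels (π ⟨$⟩ˡ_)
    ; val          = onLabels (π ⟨$⟩ʳ_)
    ; pos≤n        = onLabels≤n (π ⟨$⟩ˡ_)
    ; in-range     = onLabels-range (π ⟨$⟩ˡ_)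
    ; pos-positive = onLabels-positive (π ⟨$⟩ˡ_)
    ; pos-val      = onLabels-inverse (π ⟨$⟩ʳ_) (π ⟨$⟩ˡ_) (λ _ → inverseˡ π)
    ; val-pos      = λ 0<p → let 0<v , v≤n = onLabels-range (π ⟨$⟩ˡ_) 0<p in
        onLabels-inverse (π ⟨$⟩ˡ_) (π ⟨$⟩ʳ_) (λ _ → inverseʳ π) 0<v v≤n
    }

-- Adjacency as a pair of opposite comparisons

diff-negative : ∀ {a b} → a < b → ∃[ k ] ℤ.+ a ℤ.- ℤ.+ b ≡ ℤ.-[1+ k ]
diff-negative {a} {b} a<b with b ∸ a | m<n⇒0<n∸m a<b | trans (ℤ.m-n≡m⊖n a b) (ℤ.⊖-< a<b)
... | suc k | _ | eq = k , eq

diff-positive : ∀ {a b} → b < a → ∃[ k ] ℤ.+ a ℤ.- ℤ.+ b ≡ ℤ.+[1+ k ]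
diff-positive {a} {b} b<a with a ∸ b | m<n⇒0<n∸m b<a | trans (ℤ.m-n≡m⊖n a b) (ℤ.⊖-≥ (<⇒≤ b<a))
... | suc k | _ | eq = k , eq

module _ {a b c d : ℕ} where

  private
    product : ℤ
    product = (ℤ.+ a ℤ.- ℤ.+ b) ℤ.* (ℤ.+ c ℤ.- ℤ.+ d)

  opposite⇒negative : (a < b × d < c) ⊎ (b < a × c < d) → product ℤ.< 0ℤ
  opposite⇒negative (inj₁ (a<b , d<c)) with diff-negative a<b | diff-positive d<c
  ... | _ , e₁ | _ , e₂ = subst (ℤ._< 0ℤ) (sym (cong₂ ℤ._*_ e₁ e₂)) ℤ.-<+
  opposite⇒negative (inj₂ (b<a , c<d)) with diff-positive b<a | diff-negative c<d
  ... | _ , e₁ | _ , e₂ = subst (ℤ._< 0ℤ) (sym (cong₂ ℤ._*_ e₁ e₂)) ℤ.-<+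

  negative⇒opposite : product ℤ.< 0ℤ → (a < b × d < c) ⊎ (b < a × c < d)
  negative⇒opposite neg with <-cmp a b | <-cmp c d
  ... | tri< a<b _ _ | tri> _ _ d<c = inj₁ (a<b , d<c)
  ... | tri> _ _ b<a | tri< c<d _ _ = inj₂ (b<a , c<d)
  ... | tri≈ _ refl _ | _ =
    contradiction (subst (ℤ._< 0ℤ) (cong (ℤ._* _) (ℤ.+-inverseʳ (ℤ.+ a))) neg) (ℤ.<-irrefl refl)
  ... | tri< _ _ _ | tri≈ _ refl _ = contradiction (subst (ℤ._< 0ℤ) flat neg) (ℤ.<-irrefl refl)
    where flat = trans (cong (ℤ._*_ (ℤ.+ a ℤ.- ℤ.+ b)) (ℤ.+-inverseʳ (ℤ.+ c))) (ℤ.*-zeroʳ (ℤ.+ a ℤ.- ℤ.+ b))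
  ... | tri> _ _ _ | tri≈ _ refl _ = contradiction (subst (ℤ._< 0ℤ) flat neg) (ℤ.<-irrefl refl)
    where flat = trans (cong (ℤ._*_ (ℤ.+ a ℤ.- ℤ.+ b)) (ℤ.+-inverseʳ (ℤ.+ c))) (ℤ.*-zeroʳ (ℤ.+ a ℤ.- ℤ.+ b))
  ... | tri< a<b _ _ | tri< c<d _ _ with diff-negative a<b | diff-negative c<d
  ...   | _ , e₁ | _ , e₂ with subst (ℤ._< 0ℤ) (cong₂ ℤ._*_ e₁ e₂) neg
  ...     | ℤ.+<+ ()
  negative⇒opposite neg | tri> _ _ b<a | tri> _ _ d<c with diff-positive b<a | diff-positive d<c
  ...   | _ , e₁ | _ , e₂ with subst (ℤ._< 0ℤ) (cong₂ ℤ._*_ e₁ e₂) neg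
  ...     | ℤ.+<+ ()

-- Sorting by given comparisons

allPairs-lookup : ∀ {R : C → C → Set} {xs x y} → AllPairs R xs → x ∈ xs → y ∈ xs → x ≢ y → R x y ⊎ R y x
allPairs-lookup (_ ∷ _)  (here refl) (here refl) x≢y = contradiction refl x≢y
allPairs-lookup (h ∷ _)  (here refl) (there y∈)  _   = inj₁ (All.lookup h y∈)
allPairs-lookup (h ∷ _)  (there x∈)  (here refl) _   = inj₂ (All.lookup h x∈)
allPairs-lookup (_ ∷ ps) (there x∈)  (there y∈)  x≢y = allPairs-lookup ps x∈ y∈ x≢y

allPairs-map∈ : ∀ {R S : C → C → Set} {xs} → (∀ {x y} → x ∈ xs → y ∈ xs → R x y → S x y) →
                AllPairs R xs → AllPairs S xs
allPairs-map∈ f []       = []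
allPairs-map∈ f (h ∷ ps) =
  All.tabulate (λ y∈ → f (here refl) (there y∈) (All.lookup h y∈)) ∷
  allPairs-map∈ (λ x∈ y∈ → f (there x∈) (there y∈)) ps

module _ {_≺_ : C → C → Set} (≺-trans : ∀ {x y z} → x ≺ y → y ≺ z → x ≺ z) where

  -- `transfer` ranges over all predicates because the comparison evidence itself has to follow the
  -- elements to their new places.
  record Arranged (xs : List C) : Set₁ where
    field
      {list}   : List C
      length≡  : length list ≡ length xs
      ordered  : AllPairs _≺_ list
      transfer : ∀ {P : C → Set} → All P xs → All P list

  insert : ∀ x {ys} → AllPairs _≺_ ys → All (λ y → x ≺ y ⊎ y ≺ x) ys → Arranged (x ∷ ys)
  insert x [] [] = record { length≡ = refl ; ordered = [] ∷ [] ; transfer = id }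
  insert x (h ∷ ps) (inj₁ x≺y ∷ cs) = record
    { length≡ = refl ; ordered = (x≺y ∷ All.map (≺-trans x≺y) h) ∷ h ∷ ps ; transfer = id }
  insert x (h ∷ ps) (inj₂ y≺x ∷ cs) = record
    { length≡  = cong suc length≡
    ; ordered  = transfer (y≺x ∷ h) ∷ ordered
    ; transfer = λ { (px ∷ py ∷ pys) → py ∷ transfer (px ∷ pys) }
    }
    where open Arranged (insert x ps cs)

  -- Insertion sort driven by evidence between the members at hand: `_≺_` compares the edges of an
  -- induced matching, not arbitrary pairs of vertices.
  arrange : ∀ {xs} → AllPairs (λ x y → x ≺ y ⊎ y ≺ x) xs → Arranged xs
  arrange [] = record { length≡ = refl ; ordered = [] ; transfer = id }
  arrange {x ∷ xs} (h ∷ ps) = record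
    { length≡  = trans (Arranged.length≡ new) (cong suc length≡)
    ; ordered  = Arranged.ordered new
    ; transfer = λ { (px ∷ pxs) → Arranged.transfer new (px ∷ transfer pxs) }
    }
    where
    open Arranged (arrange ps)
    new : Arranged (x ∷ list)
    new = insert x ordered (transfer h)

module _ {n : ℕ} (π : Permutation′ n) where
  open Positions (permutationPositions π)
  open Sweep (permutationPositions π)
  open Graph (permutationGraph π)

  posLabel : ∀ u → pos (label u) ≡ label (π ⟨$⟩ˡ u)
  posLabel = onLabels-label (π ⟨$⟩ˡ_)

  adjacent⇒ : ∀ {u v} → u ~ v → Edge (label u) (label v) ⊎ Edge (label v) (label u)
  adjacent⇒ {u} {v} u~v rewrite posLabel u | posLabel v = negative⇒opposite u~v

  ⇒adjacent : ∀ {u v} → Edge (label u) (label v) → u ~ v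
  ⇒adjacent {u} {v} e rewrite posLabel u | posLabel v = opposite⇒negative (inj₁ e)

  Below : Fin n → Fin n → Set
  Below u v = label u < label v × pos (label u) < pos (label v)

  below⇒¬adjacent : ∀ {u v} → Below u v → ¬ (u ~ v)
  below⇒¬adjacent (l , p) u~v with adjacent⇒ u~v
  ... | inj₁ (_ , p′) = <-asym p p′
  ... | inj₂ (l′ , _) = <-asym l l′

  posLabel-injective : ∀ {u v : Fin n} → pos (label u) ≡ pos (label v) → label u ≡ label v
  posLabel-injective {u} = pos-injective (pos-positive z<s (label≤n u))

  ¬adjacent⇒below : ∀ {u v} → u ≢ v → ¬ (u ~ v) → Below u v ⊎ Below v u
  ¬adjacent⇒below {u} {v} u≢v ¬u~v
    with <-cmp (label u) (label v) | <-cmp (pos (label u)) (pos (label v))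
  ... | tri≈ _ e _ | _          = contradiction (toℕ-injective (suc-injective e)) u≢v
  ... | _          | tri≈ _ e _ = contradiction (toℕ-injective (suc-injective (posLabel-injective e))) u≢v
  ... | tri< l _ _ | tri< p _ _ = inj₁ (l , p)
  ... | tri> _ _ l | tri> _ _ p = inj₂ (l , p)
  ... | tri< l _ _ | tri> _ _ p = contradiction (⇒adjacent (l , p)) ¬u~v
  ... | tri> _ _ l | tri< p _ _ = contradiction (~-sym {v} {u} (⇒adjacent (l , p))) ¬u~v

  IsEdge : Fin n × Fin n → Set
  IsEdge (u , v) = Edge (label u) (label v)

  -- The edge property of both pairs is included because transitivity passes through the endpoints
  -- of the middle pair.
  _≺_ : Fin n × Fin n → Fin n × Fin n → Set
  (u₁ , v₁) ≺ (u₂ , v₂) =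
    label v₁ < label u₂ × pos (label u₁) < pos (label v₂) × IsEdge (u₁ , v₁) × IsEdge (u₂ , v₂)

  ≺-trans : ∀ {e f g} → e ≺ f → f ≺ g → e ≺ g
  ≺-trans (l₁ , p₁ , e , f) (l₂ , p₂ , _ , g) =
    <-trans l₁ (<-trans (proj₁ f) l₂) , <-trans p₁ (<-trans (proj₂ f) p₂) , e , g

  ≺⇒≢ : ∀ {e f} → e ≺ f → e ≢ f
  ≺⇒≢ (l , _ , e , _) refl = <-asym l (proj₁ e)

  ≺-below : ∀ {u₁ v₁ u₂ v₂} → (u₁ , v₁) ≺ (u₂ , v₂) →
            Below u₁ u₂ × Below u₁ v₂ × Below v₁ u₂ × Below v₁ v₂
  ≺-below (l , p , (u₁<v₁ , pv₁<pu₁) , (u₂<v₂ , pv₂<pu₂)) =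
    (<-trans u₁<v₁ l , <-trans p pv₂<pu₂) ,
    (<-trans u₁<v₁ (<-trans l u₂<v₂) , p) ,
    (l , <-trans pv₁<pu₁ (<-trans p pv₂<pu₂)) ,
    (<-trans l u₂<v₂ , <-trans pv₁<pu₁ p)

  edge∈ : ∀ {u v} → Edge (label u) (label v) → (u , v) ∈ edges (permutationGraph π)
  edge∈ {u} {v} e = ∈-filter⁺ _ (∈-cartesianProduct⁺ (∈-allFin u) (∈-allFin v))
    (s≤s⁻¹ (proj₁ e) , ⇒adjacent e)

  ∈⇒edge : ∀ {u v} → (u , v) ∈ edges (permutationGraph π) → Edge (label u) (label v)
  ∈⇒edge {u} {v} e∈ with ∈-filter⁻ _ {xs = cartesianProduct (allFin n) (allFin n)} e∈
  ... | _ , u<v , u~v with adjacent⇒ u~v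
  ...   | inj₁ e         = e
  ...   | inj₂ (v<u , _) = contradiction (s≤s u<v) (<-asym v<u)

  ordered⇒inducedMatching : ∀ {M} → All IsEdge M → AllPairs _≺_ M → IsInducedMatching (permutationGraph π) M
  ordered⇒inducedMatching es ps = record
    { unique  = AllPairs.map ≺⇒≢ ps
    ; subset  = λ e∈ → edge∈ (All.lookup es e∈)
    ; induced = λ {u₁} {v₁} {u₂} {v₂} e∈ f∈ e≢f → case allPairs-lookup ps e∈ f∈ e≢f of λ where
        (inj₁ e≺f) → let a , b , c , d = ≺-below e≺f in
          below⇒¬adjacent a , below⇒¬adjacent b , below⇒¬adjacent c , below⇒¬adjacent d
        (inj₂ f≺e) → let a , b , c , d = ≺-below f≺e in
          below⇒¬adjacent a ∘ ~-sym {u₁} {u₂} , below⇒¬adjacent c ∘ ~-sym {u₁} {v₂} ,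
          below⇒¬adjacent b ∘ ~-sym {v₁} {u₂} , below⇒¬adjacent d ∘ ~-sym {v₁} {v₂}
    }

  ordered⇒chain : ∀ {M lo x} → All (λ (u , v) → lo < label u × x < pos (label v)) M →
                  All IsEdge M → AllPairs _≺_ M → Chain lo x (length M)
  ordered⇒chain []              []       []       = []
  ordered⇒chain ((l , p) ∷ _) (e ∷ es) (h ∷ ps) =
    cons l p e (ordered⇒chain (All.map (λ (l′ , p′ , _) → l′ , p′) h) es ps)

  inducedMatching⇒chain : ∀ {M} → IsInducedMatching (permutationGraph π) M → Chain 0 0 (length M)
  inducedMatching⇒chain {M} matching = subst (Chain 0 0) length≡
    (ordered⇒chain (All.universal (λ (u , v) → z<s , pos-positive z<s (label≤n v)) list) (transfer isEdges) ordered)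
    where
    open IsInducedMatching matching

    isEdges : All IsEdge M
    isEdges = All.tabulate (∈⇒edge ∘ subset)

    -- The non-adjacent pairs `v₁`, `u₂` and `u₁`, `v₂` decide the order. Mixed outcomes are
    -- impossible: `u₁ < v₁ < u₂ < v₂` excludes `v₂ < u₁`, and the same cycle arises among the
    -- positions.
    comparable : ∀ {e f} → e ∈ M → f ∈ M → e ≢ f → e ≺ f ⊎ f ≺ e
    comparable {u₁ , v₁} {u₂ , v₂} e∈ f∈ e≢f = decide
      (¬adjacent⇒below v₁≢u₂ ¬v₁u₂) (¬adjacent⇒below u₁≢v₂ ¬u₁v₂)
      where
      e = ∈⇒edge (subset e∈)
      f = ∈⇒edge (subset f∈)
      nonadjacent = induced e∈ f∈ e≢f
      ¬u₁u₂ = proj₁ nonadjacent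
      ¬u₁v₂ = proj₁ (proj₂ nonadjacent)
      ¬v₁u₂ = proj₁ (proj₂ (proj₂ nonadjacent))
      ¬v₁v₂ = proj₂ (proj₂ (proj₂ nonadjacent))

      -- A shared endpoint would turn one of the two edges into an adjacency of `u₁` and `u₂`.
      v₁≢u₂ : v₁ ≢ u₂
      v₁≢u₂ refl = ¬u₁u₂ (⇒adjacent e)

      u₁≢v₂ : u₁ ≢ v₂
      u₁≢v₂ refl = ¬u₁u₂ (~-sym {u₂} {v₂} (⇒adjacent f))

      decide : Below v₁ u₂ ⊎ Below u₂ v₁ → Below u₁ v₂ ⊎ Below v₂ u₁ →
               (u₁ , v₁) ≺ (u₂ , v₂) ⊎ (u₂ , v₂) ≺ (u₁ , v₁)
      decide (inj₁ (l , _))   (inj₁ (_ , p)) = inj₁ (l , p , e , f)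
      decide (inj₂ (_ , p))   (inj₂ (l , _)) = inj₂ (l , p , f , e)
      decide (inj₁ (l , _))   (inj₂ (l′ , _)) =
        contradiction (<-trans (proj₁ e) (<-trans l (proj₁ f))) (<-asym l′)
      decide (inj₂ (_ , p))   (inj₁ (_ , p′)) =
        contradiction (<-trans p (<-trans (proj₂ e) p′)) (<-asym (proj₂ f))

    open Arranged (arrange {_≺_ = _≺_} ≺-trans (allPairs-map∈ comparable unique))

  module _ {A : Arrays} where

    private
      endpoints : ∀ {p} → 0 < pos p → Edge (A partner p) p →
                  (∃[ u ] label {n} u ≡ A partner p) × (∃[ v ] label {n} v ≡ p)
      endpoints 0<p (_ , p<q) =
        (let 0<u , u≤n = in-range (<-trans 0<p p<q) in vertex 0<u u≤n) ,
        (let 0<v , v≤n = in-range 0<p in vertex 0<v v≤n)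

    record Matching (lo x k : ℕ) (es : List (ℕ × ℕ)) : Set where
      field
        {list}  : List (Fin n × Fin n)
        length≡ : length list ≡ k
        labels≡ : map (λ (u , v) → label u , label v) list ≡ es
        bounded : All (λ (u , v) → lo < label u × x < pos (label v)) list
        isEdges : All IsEdge list
        ordered : AllPairs _≺_ list

    linked⇒matching : ∀ {W room lo x r k} (l : Linked A lo x r k) →
                      Matching lo x k (Execution.pairs (permutationPositions π) W room l)
    linked⇒matching [] = record
      { length≡ = refl ; labels≡ = refl ; bounded = [] ; isEdges = [] ; ordered = [] }
    linked⇒matching {W} {room} (cons lo<q x<p e l)
      with endpoints (≤-<-trans z≤n x<p) e | linked⇒matching {W} {room} l
    ... | (u , u≡) , (v , v≡) | rest = record
      { length≡ = cong suc length≡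
      ; labels≡ = cong₂ _∷_ (cong₂ _,_ u≡ v≡) labels≡
      ; bounded = (subst (_ <_) (sym u≡) lo<q , subst (λ p → _ < pos p) (sym v≡) x<p) ∷
                  All.map (λ (l , p) → <-trans (<-trans lo<q (proj₁ e)) l ,
                                       <-trans (<-trans x<p (proj₂ e)) p) bounded
      ; isEdges = e′ ∷ isEdges
      -- A chain relates consecutive edges only; `bounded` for the tail compares the first edge with
      -- all later ones at once.
      ; ordered = All.zipWith
          (λ ((l , p) , f) → subst (_< _) (sym v≡) l , subst (λ q → pos q < _) (sym u≡) p , e′ , f)
          (bounded , isEdges) ∷ ordered
      }
      where
      open Matching rest
      e′ : IsEdge (u , v)
      e′ = subst₂ Edge (sym u≡) (sym v≡) e

-- Counting edges, and the running time

listSum : List C → (C → ℕ) → ℕ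
listSum xs f = sum (map f xs)

module _ {A B : Set} {P : A × B → Set} (P? : ∀ e → Dec (P e)) where

  length-filter-row : ∀ x ys → length (filter P? (map (x ,_) ys)) ≡ listSum ys (λ y → 𝟙 (P? (x , y)))
  length-filter-row x []       = refl
  length-filter-row x (y ∷ ys) with P? (x , y)
  ... | yes _ = cong suc (length-filter-row x ys)
  ... | no _  = length-filter-row x ys

  length-filter-product : ∀ xs ys → length (filter P? (cartesianProduct xs ys)) ≡
                          listSum xs (λ x → listSum ys (λ y → 𝟙 (P? (x , y))))
  length-filter-product []       ys = refl
  length-filter-product (x ∷ xs) ys = begin
    length (filter P? (map (x ,_) ys ++ cartesianProduct xs ys))
      ≡⟨ cong length (filter-++ P? (map (x ,_) ys) _) ⟩
    length (filter P? (map (x ,_) ys) ++ filter P? (cartesianProduct xs ys))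
      ≡⟨ length-++ (filter P? (map (x ,_) ys)) ⟩
    length (filter P? (map (x ,_) ys)) + length (filter P? (cartesianProduct xs ys))
      ≡⟨ cong₂ _+_ (length-filter-row x ys) (length-filter-product xs ys) ⟩
    listSum (x ∷ xs) (λ x → listSum ys (λ y → 𝟙 (P? (x , y)))) ∎
    where open ≡-Reasoning

sumTo≤sum-tabulate : ∀ {A : Set} n {F : ℕ → ℕ} {f : A → ℕ} (g : Fin n → A) → (∀ i → F (toℕ i) ≤ f (g i)) →
                     sumTo n F ≤ listSum (tabulate g) f
sumTo≤sum-tabulate zero        g F≤f = z≤n
sumTo≤sum-tabulate (suc n) {F} g F≤f = ≤-trans (≤-reflexive (sumTo-head n F))
  (+-mono-≤ (F≤f Fin.zero) (sumTo≤sum-tabulate n (g ∘ Fin.suc) (F≤f ∘ Fin.suc)))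

contents-beyond : ∀ xs {a} → length xs ≤ a → contents xs a ≡ 0
contents-beyond []                 _       = refl
contents-beyond (x ∷ xs) {suc a} (s≤s xs≤) = contents-beyond xs xs≤

contents-tabulate : ∀ {n} (f : Fin n → ℕ) {m} (g : Fin m → Fin n) i → contents (map f (tabulate g)) (toℕ i) ≡ f (g i)
contents-tabulate f g Fin.zero    = refl
contents-tabulate f g (Fin.suc i) = contents-tabulate f (g ∘ Fin.suc) i

module _ {W : ℕ} where

  run : ∀ {σ τ b} → _⟶⟨_⟩_ W σ b τ → fetch program (State.pc τ) ≡ just halt →
        ∃[ t ] (Run W program σ t τ × t ≤ suc b)
  run done    h = 1 , halt h , s≤s z≤n
  run (s ∷ r) h = let t , r′ , t≤ = run r h in suc t , step s r′ , s≤s t≤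

-- Origin of the exponent: one factor `2 + n` remains and the other four, each at least 2, supply
-- the 16.
room : ∀ n → 16 * (2 + n) ≤ (2 + n) ^ 5
room n = ≤-trans (≤-reflexive (*-comm 16 (2 + n)))
  (*-monoʳ-≤ (2 + n) {16} {(2 + n) ^ 4} (^-monoˡ-≤ 4 {2} {2 + n} (s≤s (s≤s z≤n))))

module _ {n : ℕ} (π : Permutation′ n) where
  open Positions (permutationPositions π)
  open Sweep (permutationPositions π)
  open Execution (permutationPositions π) ((2 + n) ^ 5) (room n)

  private
    m = ∣E∣ (permutationGraph π)

  inversions≤edges : sumTo (suc n) (λ u → sumTo (suc n) (I u)) ≤ m
  inversions≤edges = begin
    sumTo (suc n) (λ u → sumTo (suc n) (I u))
      ≡⟨ sumTo-head n _ ⟩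
    sumTo (suc n) (I 0) + sumTo n (λ u → sumTo (suc n) (I (suc u)))
      ≡⟨ cong (_+ sumTo n (λ u → sumTo (suc n) (I (suc u)))) first-row ⟩
    sumTo n (λ u → sumTo (suc n) (I (suc u)))
      ≤⟨ sumTo-mono n (λ u → ≤-reflexive (sumTo-head n (I (suc u)))) ⟩
    sumTo n (λ u → I (suc u) 0 + sumTo n (I (suc u) ∘ suc))
      ≤⟨ sumTo-mono n (λ u → +-monoˡ-≤ _ (≤-reflexive (𝟙-no (inversion? (suc u) 0) λ ()))) ⟩
    sumTo n (λ u → sumTo n (I (suc u) ∘ suc))
      ≤⟨ sumTo≤sum-tabulate n id (λ u → sumTo≤sum-tabulate n id (λ v →
           𝟙-mono (inversion? (label u) (label v)) (isEdge? (u , v))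
             (λ (u<v , _ , p) → s≤s⁻¹ u<v , ⇒adjacent π (u<v , p)))) ⟩
    listSum (allFin n) (λ u → listSum (allFin n) (λ v → 𝟙 (isEdge? (u , v))))
      ≡⟨ length-filter-product isEdge? (allFin n) (allFin n) ⟨
    m ∎
    where
    open ≤-Reasoning
    open Graph (permutationGraph π)

    isEdge? : ∀ (e : Fin n × Fin n) → Dec (proj₁ e Fin.< proj₂ e × proj₁ e ~ proj₂ e)
    isEdge? (u , v) = (u Fin.<? v) ×-dec (u ~? v)

    first-row : sumTo (suc n) (I 0) ≡ 0
    first-row = trans (sumTo-cong (suc n) (λ v _ → 𝟙-no (inversion? 0 v) λ ())) (sumTo-0 (suc n))

  -- Handshake: exchanging the two summations turns the count of lower neighbours into that of upper
  -- ones.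
  degrees≤2m : sumTo (suc n) degree ≤ m + m
  degrees≤2m = ≤-trans
    (≤-reflexive (trans (sumTo-+ (suc n) (λ p → sumTo (suc n) (I p)) (λ p → sumTo (suc n) (λ u → I u p)))
      (cong (sumTo (suc n) (λ p → sumTo (suc n) (I p)) +_) (sumTo-swap (suc n) (suc n) (λ p u → I u p)))))
    (+-mono-≤ inversions≤edges inversions≤edges)

  -- The bound adds up to 23 + 52m + 94n; 100 rounds all three coefficients up.
  total-time : suc (22 + budget n + n * 11) ≤ 100 * (1 + m + n)
  total-time = ≤-trans (+-monoʳ-≤ 23 (+-monoˡ-≤ (n * 11) (+-monoʳ-≤ (83 * n) (*-monoʳ-≤ 26
      (≤-trans (sumTo-mono (suc n) (λ p → ≤-trans (*-monoˡ-≤ (degree p) (𝟙≤1 (pos p ≤? n)))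
                                           (≤-reflexive (*-identityˡ (degree p)))))
        degrees≤2m)))))
    (≤-trans (m≤m+n _ (77 + 48 * m + 6 * n)) (≤-reflexive (regroup m n)))
    where
    regroup : ∀ m n → 23 + (83 * n + 26 * (m + m) + n * 11) + (77 + 48 * m + 6 * n) ≡ 100 * (1 + m + n)
    regroup = solve-∀

  initial-rep : Rep (λ _ _ → 0) (contents (encodePermutation π))
  initial-rep = record
    { fields = λ f j → contents-beyond (encodePermutation π) (≤-trans (≤-reflexive (cong suc length≡n)) (n<addr f j))
    ; input  = λ 0<i i≤n → input′ 0<i i≤n
    }
    where
    length≡n : length (map (λ i → label (π ⟨$⟩ʳ i)) (allFin n)) ≡ n
    length≡n = trans (length-map _ (allFin n)) (length-tabulate id)

    input′ : ∀ {i} → 0 < i → i ≤ n → contents (encodePermutation π) i ≡ val i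
    input′ 0<i i≤n with vertex 0<i i≤n
    ... | u , refl = trans (contents-tabulate (λ i → label (π ⟨$⟩ʳ i)) id u) (sym (onLabels-label (π ⟨$⟩ʳ_) u))

  encodeEdges-labels : ∀ (M : List (Fin n × Fin n)) →
                       encodeEdges M ≡ length M ∷ flatten (map (λ (u , v) → label u , label v) M)
  encodeEdges-labels M = cong (length M ∷_) (go M)
    where
    go : ∀ (M : List (Fin n × Fin n)) → concatMap (λ (u , v) → label u ∷ label v ∷ []) M ≡
         flatten (map (λ (u , v) → label u , label v) M)
    go []      = refl
    go (e ∷ M) = cong (λ xs → _ ∷ _ ∷ xs) (go M)

  correctness : ∃[ t ] ∃[ τ ] ∃[ M ]
    ( Run ((2 + n) ^ 5) program (initial (encodePermutation π)) t τ
    × t ≤ 100 * (1 + m + n)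
    × Outputs τ M
    × IsMaximumInducedMatching (permutationGraph π) M)
  correctness = t , _ , list , halts , ≤-trans t≤ total-time ,
    subst (StoredAt m′ 0)
      (sym (trans (encodeEdges-labels list) (cong₂ (λ k es → k ∷ flatten es) length≡ labels≡))) stored ,
    ordered⇒inducedMatching π isEdges ordered ,
    λ M′ matching → ≤-trans (answer-maximum refl initial-rep (inducedMatching⇒chain π matching))
                            (≤-reflexive (sym length≡))
    where
    open Emitted (execution refl initial-rep) renaming (run to trace)
    open Matching (linked⇒matching π {W = (2 + n) ^ 5} {room n} (answer refl initial-rep))

    terminated = run trace refl
    t = proj₁ terminated
    halts = proj₁ (proj₂ terminated)
    t≤ = proj₂ (proj₂ terminated)

theorem2 : ∃[ P ] ∃[ c ] ∃[ k ]
    ((n : ℕ) (π : Permutation′ n) →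
    ∃[ t ] ∃[ τ ] ∃[ M ]
    ( Run ((2 + n) ^ k) P (initial (encodePermutation π)) t τ
    × t ≤ c * (1 + ∣E∣ (permutationGraph π) + n)
    × Outputs τ M
    × IsMaximumInducedMatching (permutationGraph π) M))
theorem2 = program , 100 , 5 , λ n π → correctness π
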